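{- Let $k\ge1$ be an integer. If $\mathcal S=\{a_1<\cdots<a_m\}\subset\mathbb N$ is a $\mathcal D_k$ set, then, as $m\to\infty$, $$a_m\ \ge\ (1+o(1))\,\frac{(k+1)^m}{2}\sqrt{\frac{6}{m\pi k(k+2)}}.$$ Consequently, for an infinite $\mathcal D_k$ set $\mathcal S\subseteq\mathbb N$, as $n\to\infty$, $$|\mathcal S(n)|\ \le\ \log_{k+1}n+\frac12\log_{k+1}\log_2 n+\frac12\log_{k+1}\left(\frac{2\pi}{3}k(k+2)\right)+o(1),$$ where $\mathcal S(n):=\mathcal S\cap[1,n]$.
   Context: For a positive integer $k$, a set $\mathcal S\subseteq\mathbb N$ is a $\mathcal D_k$ set if any equality $\sum_{s\in\mathcal S}\varepsilon_s s=0$ with $\varepsilon_s\in\{ -k,\dots,-1,0,1,\dots,k\}$ (only finitely many nonzero) implies that all $\varepsilon_s$ are $0$. -}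

module Defs where

open import Algebra.Bundles using (CommutativeRing)
open import Data.Bool.Base using (if_then_else_; true; false)
open import Data.Fin.Base using (Fin)
open import Data.Integer.Base as ℤ using (ℤ; +_; 0ℤ; +[1+_]; -[1+_])
import Data.Integer.Properties as ℤ
open import Data.List.Base using (List; foldr; length; map)
open import Data.List.Membership.Propositional using (_∈_)
open import Data.List.Relation.Unary.All using (All)
open import Data.List.Relation.Unary.Unique.Propositional using (Unique)
open import Data.Nat.Base as ℕ using (ℕ; zero; suc; NonZero; NonTrivial; z≤n; s≤s)
import Data.Nat.Properties as ℕ
import Data.Nat.Tactic.RingSolver as ℕ-Solver
open import Data.Product.Base using (_×_; _,_; ∃-syntax)
open import Data.Rational.Base as ℚ using (ℚ; mkℚ; 0ℚ; 1ℚ; ½; ↥_; toℚᵘ; *≤*; *<*)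
open import Data.Rational.Literals using (fromℤ)
import Data.Rational.Properties as ℚ
open import Data.Rational.Unnormalised.Base as ℚᵘ using (ℚᵘ; mkℚᵘ; *≡*)
import Data.Rational.Unnormalised.Properties as ℚᵘ
open import Data.Sum.Base as Sum using (_⊎_; inj₁; inj₂)
open import Function.Bundles using (_⇔_)
open import Level using (0ℓ)
open import Relation.Binary.PropositionalEquality
open import Relation.Nullary using (yes; no; does; contradiction)
open import Relation.Nullary.Decidable using (dec⇒maybe)
open import Relation.Unary using (Pred; Decidable)
open import Tactic.RingSolver using (solve-∀)
open import Tactic.RingSolver.Core.AlmostCommutativeRing using (AlmostCommutativeRing; fromCommutativeRing)

open import Algebra.Definitions.RawSemiring ℚ.+-*-rawSemiring using () renaming (_^_ to _^ℚ_)
import Algebra.Properties.CommutativeSemiring.Exp (CommutativeRing.commutativeSemiring ℚ.+-*-commutativeRing) as Exp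

-- The largest i ≤ n satisfying P, or 0 if there is none.

greatest : {P : Pred ℕ 0ℓ} → Decidable P → ℕ → ℕ
greatest P? zero = zero
greatest P? (suc n) = if does (P? (suc n)) then suc n else greatest P? n

greatest-spec : {P : Pred ℕ 0ℓ} (P? : Decidable P) → ∀ n →
                P (greatest P? n) ⊎ greatest P? n ≡ 0
greatest-spec P? zero = inj₂ refl
greatest-spec P? (suc n) with P? (suc n)
... | yes p = inj₁ p
... | no _ = greatest-spec P? n

greatest-max : {P : Pred ℕ 0ℓ} (P? : Decidable P) → ∀ {i n} → i ℕ.≤ n → P i → i ℕ.≤ greatest P? n
greatest-max P? {n = zero} i≤n Pi = i≤n
greatest-max P? {i} {suc n} i≤n Pi with P? (suc n)
... | yes _ = i≤n
... | no ¬p with ℕ.m≤n⇒m<n∨m≡n i≤n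
...   | inj₁ (s≤s i≤n′) = greatest-max P? i≤n′ Pi
...   | inj₂ refl = contradiction Pi ¬p

greatest≤ : {P : Pred ℕ 0ℓ} (P? : Decidable P) → ∀ n → greatest P? n ℕ.≤ n
greatest≤ P? zero = z≤n
greatest≤ P? (suc n) with P? (suc n)
... | yes _ = ℕ.≤-refl
... | no _ = ℕ.m≤n⇒m≤1+n (greatest≤ P? n)

module Rational where

  open import Data.Rational.Base public using (_/_; _+_; _*_; _-_; -_; _≤_; _<_; _⊔_; ∣_∣)

  ring : AlmostCommutativeRing 0ℓ 0ℓ
  ring = fromCommutativeRing ℚ.+-*-commutativeRing (λ x → dec⇒maybe (0ℚ ℚ.≟ x))

  ι : ℕ → ℚ
  ι n = fromℤ (+ n)

  toℚᵘ-/ : ∀ i n → toℚᵘ (i / suc n) ℚᵘ.≃ mkℚᵘ i n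
  toℚᵘ-/ i n = ℚ.toℚᵘ-fromℚᵘ (mkℚᵘ i n)

  ι-+ : ∀ m n → ι (m ℕ.+ n) ≡ ι m + ι n
  ι-+ m n = ℚ.toℚᵘ-injective (ℚᵘ.≃-sym (ℚᵘ.≃-trans (ℚ.toℚᵘ-homo-+ (ι m) (ι n))
    (*≡* (cong₂ (λ x y → (x ℤ.+ y) ℤ.* + 1) (ℤ.*-identityʳ (+ m)) (ℤ.*-identityʳ (+ n))))))

  ι-* : ∀ m n → ι (m ℕ.* n) ≡ ι m * ι n
  ι-* m n = ℚ.toℚᵘ-injective (ℚᵘ.≃-sym (ℚᵘ.≃-trans (ℚ.toℚᵘ-homo-* (ι m) (ι n))
    (*≡* (cong (ℤ._* + 1) (sym (ℤ.pos-* m n))))))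

  /-cancel : ∀ p n → (+ p / suc n) * ι (suc n) ≡ ι p
  /-cancel p n = ℚ.toℚᵘ-injective (ℚᵘ.≃-trans (ℚ.toℚᵘ-homo-* (+ p / suc n) (ι (suc n)))
    (ℚᵘ.≃-trans (ℚᵘ.*-cong (toℚᵘ-/ (+ p) n) (ℚᵘ.≃-refl {mkℚᵘ (+ suc n) 0}))
    (*≡* (trans (ℤ.*-identityʳ (+ p ℤ.* + suc n)) (cong (λ k → + p ℤ.* + suc k) (sym (ℕ.*-identityʳ n)))))))

  ι-mono-≤ : ∀ {m n} → m ℕ.≤ n → ι m ≤ ι n
  ι-mono-≤ m≤n = *≤* (ℤ.*-monoʳ-≤-nonNeg (+ 1) (ℤ.+≤+ m≤n))

  ι-mono-< : ∀ {m n} → m ℕ.< n → ι m < ι n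
  ι-mono-< m<n = *<* (ℤ.*-monoʳ-<-pos (+ 1) (ℤ.+<+ m<n))

  ι-cancel-≤ : ∀ {m n} → ι m ≤ ι n → m ℕ.≤ n
  ι-cancel-≤ {m} {n} p with m ℕ.≤? n
  ... | yes m≤n = m≤n
  ... | no m≰n = contradiction (ℚ.<-≤-trans (ι-mono-< (ℕ.≰⇒> m≰n)) p) (ℚ.<-irrefl refl)

  ≤-respˡ : ∀ {a b c} → a ≡ b → a ≤ c → b ≤ c
  ≤-respˡ refl p = p

  0≤ι : ∀ n → 0ℚ ≤ ι n
  0≤ι n = ι-mono-≤ {0} z≤n

  0<ι : ∀ n → 0ℚ < ι (suc n)
  0<ι n = ι-mono-< {0} (s≤s z≤n)

  ≤-*ʳ : ∀ {a b c} → 0ℚ ≤ c → a ≤ b → a * c ≤ b * c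
  ≤-*ʳ {c = c} 0≤c = ℚ.*-monoʳ-≤-nonNeg c {{ℚ.nonNegative 0≤c}}

  ≤-*ˡ : ∀ {a b c} → 0ℚ ≤ c → a ≤ b → c * a ≤ c * b
  ≤-*ˡ {c = c} 0≤c = ℚ.*-monoˡ-≤-nonNeg c {{ℚ.nonNegative 0≤c}}

  ≤-* : ∀ {a b c d} → 0ℚ ≤ c → 0ℚ ≤ b → a ≤ b → c ≤ d → a * c ≤ b * d
  ≤-* 0≤c 0≤b a≤b c≤d = ℚ.≤-trans (≤-*ʳ 0≤c a≤b) (≤-*ˡ 0≤b c≤d)

  0≤* : ∀ {a b} → 0ℚ ≤ a → 0ℚ ≤ b → 0ℚ ≤ a * b
  0≤* {a} {b} 0≤a 0≤b = subst (_≤ a * b) (ℚ.*-zeroˡ b) (≤-*ʳ 0≤b 0≤a)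

  0<* : ∀ {a b} → 0ℚ < a → 0ℚ < b → 0ℚ < a * b
  0<* {a} {b} 0<a 0<b = ℚ.positive⁻¹ (a * b) {{ℚ.pos*pos⇒pos a {{ℚ.positive 0<a}} b {{ℚ.positive 0<b}}}}

  cancelʳ-≤ : ∀ {a b c} → 0ℚ < c → a * c ≤ b * c → a ≤ b
  cancelʳ-≤ {c = c} 0<c = ℚ.*-cancelʳ-≤-pos c {{ℚ.positive 0<c}}

  0<+ : ∀ {a b} → 0ℚ < a → 0ℚ < b → 0ℚ < a + b
  0<+ 0<a 0<b = ℚ.+-mono-< 0<a 0<b

  0<½ : 0ℚ < ½
  0<½ = ℚ.positive⁻¹ ½

  half : ∀ {ε} → 0ℚ < ε → 0ℚ < ½ * ε
  half = 0<* 0<½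

  halves : ∀ ε → ½ * ε + ½ * ε ≡ ε
  halves = solve-∀ ring

  ≤+⇒-≤ : ∀ {a b c} → a ≤ b + c → a - b ≤ c
  ≤+⇒-≤ {a} {b} {c} p = subst (a - b ≤_) (eq b c) (ℚ.+-monoˡ-≤ (- b) p)
    where
    eq : ∀ b c → (b + c) - b ≡ c
    eq = solve-∀ ring

  -≤⇒≤+ : ∀ {a b c} → a - b ≤ c → a ≤ b + c
  -≤⇒≤+ {a} {b} {c} p = subst (_≤ b + c) (eq a b) (ℚ.+-monoʳ-≤ b p)
    where
    eq : ∀ a b → b + (a - b) ≡ a
    eq = solve-∀ ring

  ∣∣≤ : ∀ {a c} → a ≤ c → - a ≤ c → ∣ a ∣ ≤ c
  ∣∣≤ {a} p q with ℚ.∣p∣≡p∨∣p∣≡-p a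
  ... | inj₁ e = ≤-respˡ (sym e) p
  ... | inj₂ e = ≤-respˡ (sym e) q

  ≤∣∣ : ∀ a → a ≤ ∣ a ∣
  ≤∣∣ a with ℚ.≤-total 0ℚ a
  ... | inj₁ 0≤a = ℚ.≤-reflexive (sym (ℚ.0≤p⇒∣p∣≡p 0≤a))
  ... | inj₂ a≤0 = ℚ.≤-trans a≤0 (ℚ.0≤∣p∣ a)

  ≤+⇒∣∣≤ : ∀ {a b c} → a ≤ b + c → b ≤ a + c → ∣ a - b ∣ ≤ c
  ≤+⇒∣∣≤ {a} {b} {c} p q = ∣∣≤ (≤+⇒-≤ p) (≤-respˡ (eq a b) (≤+⇒-≤ q))
    where
    eq : ∀ a b → b - a ≡ - (a - b)
    eq = solve-∀ ring

  1/-spec : ∀ {q} (0<q : 0ℚ < q) → ∃[ r ] 0ℚ < r × q * r ≡ 1ℚ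
  1/-spec {q} 0<q = r , ℚ.positive⁻¹ r {{ℚ.1/pos⇒pos q {{ℚ.positive 0<q}}}} , ℚ.*-inverseʳ q {{nz}}
    where
    nz = ℚ.pos⇒nonZero q {{ℚ.positive 0<q}}
    r = ℚ.1/_ q {{nz}}

  arch : ∀ {ε} → 0ℚ < ε → ∃[ d ] ∀ n → d ℕ.≤ n → 1ℚ ≤ ε * ι (suc n)
  arch {ε@(mkℚ -[1+ _ ] _ _)} (*<* ())
  arch {ε@(mkℚ (+ 0) d _)} (*<* (ℤ.+<+ ()))
  arch {ε@(mkℚ +[1+ u ] d _)} 0<ε = d , λ n d≤n →
    ℚ.≤-trans (ℚ.≤-trans (ι-mono-≤ {1} {suc u} (s≤s z≤n)) (ℚ.≤-reflexive (sym eq)))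
              (≤-*ˡ (ℚ.<⇒≤ 0<ε) (ι-mono-≤ (s≤s d≤n)))
    where
    eq : ε * ι (suc d) ≡ ι (suc u)
    eq = trans (cong (_* ι (suc d)) (sym (ℚ.↥p/↧p≡p ε))) (/-cancel (suc u) d)

  ≤-numerator : ∀ q → q ≤ ι ℤ.∣ ↥ q ∣
  ≤-numerator q@(mkℚ -[1+ u ] d _) = ℚ.≤-trans (ℚ.<⇒≤ (ℚ.negative⁻¹ q)) (0≤ι (suc u))
  ≤-numerator q@(mkℚ (+ u) d _) = cancelʳ-≤ (0<ι d) (ℚ.≤-trans (ℚ.≤-reflexive eq)
    (ℚ.≤-trans (ι-mono-≤ (ℕ.m≤m*n u (suc d))) (ℚ.≤-reflexive (ι-* u (suc d)))))
    where
    eq : q * ι (suc d) ≡ ι u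
    eq = trans (cong (_* ι (suc d)) (sym (ℚ.↥p/↧p≡p q))) (/-cancel u d)

  ^-nonNeg : ∀ {q} n → 0ℚ ≤ q → 0ℚ ≤ q ^ℚ n
  ^-nonNeg zero 0≤q = ℚ.nonNegative⁻¹ 1ℚ
  ^-nonNeg (suc n) 0≤q = 0≤* 0≤q (^-nonNeg n 0≤q)

  ^-mono : ∀ {q r} n → 0ℚ ≤ q → q ≤ r → q ^ℚ n ≤ r ^ℚ n
  ^-mono zero 0≤q q≤r = ℚ.≤-refl
  ^-mono (suc n) 0≤q q≤r = ≤-* (^-nonNeg n 0≤q) (ℚ.≤-trans 0≤q q≤r) q≤r (^-mono n 0≤q q≤r)

  1≤^ : ∀ {q} n → 1ℚ ≤ q → 1ℚ ≤ q ^ℚ n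
  1≤^ {q} n 1≤q = ℚ.≤-trans (ℚ.≤-reflexive (sym (1^ n))) (^-mono n (ℚ.nonNegative⁻¹ 1ℚ) 1≤q)
    where
    1^ : ∀ n → 1ℚ ^ℚ n ≡ 1ℚ
    1^ zero = refl
    1^ (suc n) = trans (ℚ.*-identityˡ _) (1^ n)

  ι-^ : ∀ b n → ι (b ℕ.^ n) ≡ ι b ^ℚ n
  ι-^ b zero = refl
  ι-^ b (suc n) = trans (ι-* b (b ℕ.^ n)) (cong (ι b *_) (ι-^ b n))

module Sequence where

  open Rational

  -- As m and n are interchangeable, the inequality bounds ∣ x m - x n ∣ by ε.

  IsCauchy : (ℕ → ℚ) → Set
  IsCauchy x = ∀ ε → 0ℚ < ε → ∃[ N ] ∀ m n → N ℕ.≤ m → N ℕ.≤ n → x m ≤ x n + ε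

  module Cauchy where

    const : ∀ q → IsCauchy (λ _ → q)
    const q ε 0<ε = 0 , λ _ _ _ _ → subst (_≤ q + ε) (ℚ.+-identityʳ q) (ℚ.+-monoʳ-≤ q (ℚ.<⇒≤ 0<ε))

    add : ∀ {x y} → IsCauchy x → IsCauchy y → IsCauchy (λ n → x n + y n)
    add {x} {y} cx cy ε 0<ε with cx (½ * ε) (half 0<ε) | cy (½ * ε) (half 0<ε)
    ... | M , p | N , q = M ℕ.⊔ N , λ m n M≤m M≤n →
      ℚ.≤-trans (ℚ.+-mono-≤ (p m n (ℕ.m⊔n≤o⇒m≤o M N M≤m) (ℕ.m⊔n≤o⇒m≤o M N M≤n))
                            (q m n (ℕ.m⊔n≤o⇒n≤o M N M≤m) (ℕ.m⊔n≤o⇒n≤o M N M≤n)))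
                (ℚ.≤-reflexive (eq (x n) (y n) ε))
      where
      eq : ∀ a b ε → (a + ½ * ε) + (b + ½ * ε) ≡ (a + b) + ε
      eq = solve-∀ ring

    neg : ∀ {x} → IsCauchy x → IsCauchy (λ n → - x n)
    neg {x} cx ε 0<ε with cx ε 0<ε
    ... | N , p = N , λ m n N≤m N≤n →
      ≤-respˡ (eq (x m) (x n)) (ℚ.≤-trans (ℚ.+-monoˡ-≤ (- (x m) - x n) (p n m N≤n N≤m))
        (ℚ.≤-reflexive (eq′ (x m) (x n) ε)))
      where
      eq : ∀ a b → b + (- a - b) ≡ - a
      eq = solve-∀ ring
      eq′ : ∀ a b ε → (a + ε) + (- a - b) ≡ - b + ε
      eq′ = solve-∀ ring

    bounded : ∀ {x} → IsCauchy x → ∃[ B ] 0ℚ < B × ∃[ N ] ∀ n → N ℕ.≤ n → ∣ x n ∣ ≤ B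
    bounded {x} cx with cx 1ℚ (ℚ.positive⁻¹ 1ℚ)
    ... | N , p = ∣ x N ∣ + 1ℚ , 0<B , N , λ n N≤n →
      ≤-respˡ (cong ∣_∣ (eq (x n) (x N)))
        (ℚ.≤-trans (ℚ.∣p+q∣≤∣p∣+∣q∣ (x N) (x n - x N))
          (ℚ.+-monoʳ-≤ ∣ x N ∣ (≤+⇒∣∣≤ (p n N N≤n ℕ.≤-refl) (p N n ℕ.≤-refl N≤n))))
      where
      eq : ∀ a b → b + (a - b) ≡ a
      eq = solve-∀ ring
      0<B : 0ℚ < ∣ x N ∣ + 1ℚ
      0<B = ℚ.<-≤-trans (ℚ.positive⁻¹ 1ℚ) (≤-respˡ (ℚ.+-identityˡ 1ℚ) (ℚ.+-monoˡ-≤ 1ℚ (ℚ.0≤∣p∣ (x N))))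

    mul-bound : ∀ {B C η} a b c d → ∣ b ∣ ≤ B → ∣ c ∣ ≤ C → 0ℚ ≤ B → 0ℚ ≤ η →
                ∣ a - b ∣ ≤ η → ∣ c - d ∣ ≤ η → a * c ≤ b * d + (η * C + B * η)
    mul-bound {B} {C} {η} a b c d b≤B c≤C 0≤B 0≤η p q = -≤⇒≤+ {a * c} {b * d} (begin
      a * c - b * d                          ≡⟨ eq a b c d ⟩
      (a - b) * c + b * (c - d)              ≤⟨ ≤∣∣ ((a - b) * c + b * (c - d)) ⟩
      ∣ (a - b) * c + b * (c - d) ∣          ≤⟨ ℚ.∣p+q∣≤∣p∣+∣q∣ ((a - b) * c) (b * (c - d)) ⟩
      ∣ (a - b) * c ∣ + ∣ b * (c - d) ∣      ≡⟨ cong₂ _+_ (ℚ.∣p*q∣≡∣p∣*∣q∣ (a - b) c) (ℚ.∣p*q∣≡∣p∣*∣q∣ b (c - d)) ⟩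
      ∣ a - b ∣ * ∣ c ∣ + ∣ b ∣ * ∣ c - d ∣  ≤⟨ ℚ.+-mono-≤ {∣ a - b ∣ * ∣ c ∣} {η * C} {∣ b ∣ * ∣ c - d ∣} {B * η}
                                                  (≤-* (ℚ.0≤∣p∣ c) 0≤η p c≤C)
                                                  (≤-* (ℚ.0≤∣p∣ (c - d)) 0≤B b≤B q) ⟩
      η * C + B * η                          ∎)
      where
      open ℚ.≤-Reasoning
      eq : ∀ a b c d → a * c - b * d ≡ (a - b) * c + b * (c - d)
      eq = solve-∀ ring

    mul-scale : ∀ {B C r} ε → (B + C) * r ≡ 1ℚ → ε * r * C + B * (ε * r) ≡ ε
    mul-scale {B} {C} {r} ε e = trans (eq B C ε r) (trans (cong (ε *_) e) (ℚ.*-identityʳ ε))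
      where
      eq : ∀ B C ε r → ε * r * C + B * (ε * r) ≡ ε * ((B + C) * r)
      eq = solve-∀ ring

    mul : ∀ {x y} → IsCauchy x → IsCauchy y → IsCauchy (λ n → x n * y n)
    mul {x} {y} cx cy ε 0<ε =
      let B , 0<B , K , bx = bounded cx
          C , 0<C , L , by = bounded cy
          r , 0<r , Dr≡1 = 1/-spec (0<+ 0<B 0<C)
          0<η = 0<* 0<ε 0<r
          M , p = cx (ε * r) 0<η
          N , q = cy (ε * r) 0<η
      in (K ℕ.⊔ L) ℕ.⊔ (M ℕ.⊔ N) , λ m n h h′ →
      let KL≤m = ℕ.m⊔n≤o⇒m≤o (K ℕ.⊔ L) (M ℕ.⊔ N) h
          KL≤n = ℕ.m⊔n≤o⇒m≤o (K ℕ.⊔ L) (M ℕ.⊔ N) h′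
          MN≤m = ℕ.m⊔n≤o⇒n≤o (K ℕ.⊔ L) (M ℕ.⊔ N) h
          MN≤n = ℕ.m⊔n≤o⇒n≤o (K ℕ.⊔ L) (M ℕ.⊔ N) h′
          M≤m = ℕ.m⊔n≤o⇒m≤o M N MN≤m
          M≤n = ℕ.m⊔n≤o⇒m≤o M N MN≤n
          N≤m = ℕ.m⊔n≤o⇒n≤o M N MN≤m
          N≤n = ℕ.m⊔n≤o⇒n≤o M N MN≤n
      in subst (λ e → x m * y m ≤ x n * y n + e) (mul-scale {B} {C} {r} ε Dr≡1)
           (mul-bound {B} {C} {ε * r} (x m) (x n) (y m) (y n)
             (bx n (ℕ.m⊔n≤o⇒m≤o K L KL≤n)) (by m (ℕ.m⊔n≤o⇒n≤o K L KL≤m)) (ℚ.<⇒≤ 0<B) (ℚ.<⇒≤ 0<η)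
             (≤+⇒∣∣≤ (p m n M≤m M≤n) (p n m M≤n M≤m)) (≤+⇒∣∣≤ (q m n N≤m N≤n) (q n m N≤n N≤m)))

    -- The reciprocal, with 1 / 0 = 0.

    recip : ℚ → ℚ
    recip q with q ℚ.≟ 0ℚ
    ... | yes _ = 0ℚ
    ... | no q≢0 = ℚ.1/_ q {{ℚ.≢-nonZero q≢0}}

    recip-inverse : ∀ {q} → 0ℚ < q → q * recip q ≡ 1ℚ
    recip-inverse {q} 0<q with q ℚ.≟ 0ℚ
    ... | yes refl = contradiction 0<q (ℚ.<-irrefl refl)
    ... | no q≢0 = ℚ.*-inverseʳ q {{ℚ.≢-nonZero q≢0}}

    recip-pos : ∀ {q} → 0ℚ < q → 0ℚ < recip q
    recip-pos {q} 0<q with q ℚ.≟ 0ℚ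
    ... | yes refl = contradiction 0<q (ℚ.<-irrefl refl)
    ... | no q≢0 = ℚ.positive⁻¹ _ {{ℚ.1/pos⇒pos q {{ℚ.positive 0<q}}}}

    inv : ∀ {x δ} → IsCauchy x → 0ℚ < δ → (∃[ N ] ∀ n → N ℕ.≤ n → δ ≤ x n) → IsCauchy (λ n → recip (x n))
    inv {x} {δ} cx 0<δ (K , pos) ε 0<ε with cx (ε * (δ * δ)) (0<* 0<ε (0<* 0<δ 0<δ))
    ... | N , p = K ℕ.⊔ N , λ m n h h′ →
      main m n (pos m (ℕ.m⊔n≤o⇒m≤o K N h)) (pos n (ℕ.m⊔n≤o⇒m≤o K N h′)) (p n m (ℕ.m⊔n≤o⇒n≤o K N h′) (ℕ.m⊔n≤o⇒n≤o K N h))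
      where
      open ℚ.≤-Reasoning
      eq : ∀ a b r s → (b - a) * (r * s) ≡ (b * s) * r - (a * r) * s
      eq = solve-∀ ring
      eq′ : ∀ r s → 1ℚ * r - 1ℚ * s ≡ r - s
      eq′ = solve-∀ ring
      eq″ : ∀ e d r s → e * (d * d) * (r * s) ≡ e * ((d * r) * (d * s))
      eq″ = solve-∀ ring
      main : ∀ m n → δ ≤ x m → δ ≤ x n → x n ≤ x m + ε * (δ * δ) → recip (x m) ≤ recip (x n) + ε
      main m n δ≤a δ≤b b≤a+ = -≤⇒≤+ (begin
        r - s                          ≡⟨ eq′ r s ⟨
        1ℚ * r - 1ℚ * s                ≡⟨ cong₂ (λ u v → u * r - v * s) (recip-inverse 0<b) (recip-inverse 0<a) ⟨
        (b * s) * r - (a * r) * s      ≡⟨ eq a b r s ⟨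
        (b - a) * (r * s)              ≤⟨ ≤-*ʳ (0≤* 0≤r 0≤s) (≤+⇒-≤ b≤a+) ⟩
        ε * (δ * δ) * (r * s)          ≡⟨ eq″ ε δ r s ⟩
        ε * ((δ * r) * (δ * s))        ≤⟨ ≤-*ˡ (ℚ.<⇒≤ 0<ε) (≤-* (0≤* 0≤δ 0≤s) (ℚ.nonNegative⁻¹ 1ℚ)
                                            (ℚ.≤-trans (≤-*ʳ 0≤r δ≤a) (ℚ.≤-reflexive (recip-inverse 0<a)))
                                            (ℚ.≤-trans (≤-*ʳ 0≤s δ≤b) (ℚ.≤-reflexive (recip-inverse 0<b)))) ⟩
        ε * (1ℚ * 1ℚ)                  ≡⟨ ℚ.*-identityʳ ε ⟩
        ε                              ∎)
        where
        a = x m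
        b = x n
        r = recip a
        s = recip b
        0<a = ℚ.<-≤-trans 0<δ δ≤a
        0<b = ℚ.<-≤-trans 0<δ δ≤b
        0≤r = ℚ.<⇒≤ (recip-pos 0<a)
        0≤s = ℚ.<⇒≤ (recip-pos 0<b)
        0≤δ = ℚ.<⇒≤ 0<δ

  cancelʳ-≡ : ∀ {a b c} → 0ℚ < c → a * c ≡ b * c → a ≡ b
  cancelʳ-≡ {a} {b} {c} 0<c e = ℚ.≤-antisym (cancelʳ-≤ {a} {b} {c} 0<c (ℚ.≤-reflexive e)) (cancelʳ-≤ {b} {a} {c} 0<c (ℚ.≤-reflexive (sym e)))

  /-suc : ∀ i n → + suc i / suc n ≡ (+ i / suc n) + (+ 1 / suc n)
  /-suc i n = cancelʳ-≡ {+ suc i / suc n} {(+ i / suc n) + (+ 1 / suc n)} (0<ι n) (begin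
    (+ suc i / suc n) * ι (suc n)                             ≡⟨ /-cancel (suc i) n ⟩
    ι (suc i)                                                 ≡⟨ cong ι (ℕ.+-comm 1 i) ⟩
    ι (i ℕ.+ 1)                                               ≡⟨ ι-+ i 1 ⟩
    ι i + ι 1                                                 ≡⟨ cong₂ _+_ (/-cancel i n) (/-cancel 1 n) ⟨
    (+ i / suc n) * ι (suc n) + (+ 1 / suc n) * ι (suc n)     ≡⟨ ℚ.*-distribʳ-+ (ι (suc n)) (+ i / suc n) (+ 1 / suc n) ⟨
    ((+ i / suc n) + (+ 1 / suc n)) * ι (suc n)               ∎)
    where open ≡-Reasoning

  0≤/ : ∀ i n → 0ℚ ≤ + i / suc n
  0≤/ i n = cancelʳ-≤ {0ℚ} {+ i / suc n} (0<ι n)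
    (≤-respˡ (sym (ℚ.*-zeroˡ (ι (suc n)))) (ℚ.≤-trans (0≤ι i) (ℚ.≤-reflexive (sym (/-cancel i n)))))

  unit : ∀ {ε} → 0ℚ < ε → ∃[ d ] ∀ n → d ℕ.≤ n → + 1 / suc n ≤ ε
  unit {ε} 0<ε = let d , p = arch 0<ε in
    d , λ n d≤n → cancelʳ-≤ {+ 1 / suc n} {ε} (0<ι n) (≤-respˡ (sym (/-cancel 1 n)) (p n d≤n))

  -- sqrtApprox q n is the largest multiple of 1 / suc n whose square is at most q,
  -- or 0 if there is none.  (The bound on the search is large enough, see Sqrt.bound.)

  sqrtNumerator : ℚ → ℕ → ℕ
  sqrtNumerator q n =
    greatest (λ i → (+ i / suc n) * (+ i / suc n) ℚ.≤? q) (ℤ.∣ ↥ q ∣ ℕ.* (suc n ℕ.* suc n))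

  sqrtApprox : ℚ → ℕ → ℚ
  sqrtApprox q n = + sqrtNumerator q n / suc n

  module Sqrt where

    lower : ∀ q n → sqrtApprox q n * sqrtApprox q n ≤ q ⊎ sqrtApprox q n ≡ 0ℚ
    lower q n = Sum.map₂ (zeroNumerator (sqrtNumerator q n))
      (greatest-spec (λ i → (+ i / suc n) * (+ i / suc n) ℚ.≤? q) (ℤ.∣ ↥ q ∣ ℕ.* (suc n ℕ.* suc n)))
      where
      zeroNumerator : ∀ i → i ≡ 0 → + i / suc n ≡ 0ℚ
      zeroNumerator i refl = ℚ.0/n≡0 (suc n)

    bound : ∀ q n j → (+ j / suc n) * (+ j / suc n) ≤ q → j ℕ.≤ ℤ.∣ ↥ q ∣ ℕ.* (suc n ℕ.* suc n)
    bound q n j p = ℕ.≤-trans (j≤j*j j) (ι-cancel-≤ (begin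
      ι (j ℕ.* j)                       ≡⟨ ι-* j j ⟩
      ι j * ι j                         ≡⟨ cong₂ _*_ (/-cancel j n) (/-cancel j n) ⟨
      (s * ν) * (s * ν)                 ≡⟨ eq s ν ⟩
      (s * s) * (ν * ν)                 ≤⟨ ≤-*ʳ {s * s} {q} {ν * ν} (0≤* (0≤ι (suc n)) (0≤ι (suc n))) p ⟩
      q * (ν * ν)                       ≤⟨ ≤-*ʳ {q} {ι u} {ν * ν} (0≤* (0≤ι (suc n)) (0≤ι (suc n))) (≤-numerator q) ⟩
      ι u * (ν * ν)                     ≡⟨ cong (ι u *_) (ι-* (suc n) (suc n)) ⟨
      ι u * ι (suc n ℕ.* suc n)         ≡⟨ ι-* u (suc n ℕ.* suc n) ⟨
      ι (u ℕ.* (suc n ℕ.* suc n))       ∎))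
      where
      open ℚ.≤-Reasoning
      s = + j / suc n
      ν = ι (suc n)
      u = ℤ.∣ ↥ q ∣
      eq : ∀ s ν → (s * ν) * (s * ν) ≡ (s * s) * (ν * ν)
      eq = solve-∀ ring
      j≤j*j : ∀ j → j ℕ.≤ j ℕ.* j
      j≤j*j zero = z≤n
      j≤j*j (suc j) = ℕ.m≤m*n (suc j) (suc j)

    upper : ∀ q n → q < (sqrtApprox q n + (+ 1 / suc n)) * (sqrtApprox q n + (+ 1 / suc n))
    upper q n = subst (λ s → q < s * s) (/-suc i n) (ℚ.≰⇒> λ p →
      ℕ.<-irrefl refl (greatest-max (λ i → (+ i / suc n) * (+ i / suc n) ℚ.≤? q) (bound q n (suc i) p) p))
      where
      i = sqrtNumerator q n

    core : ∀ a b s t r h → s * s ≤ a ⊎ s ≡ 0ℚ → 0ℚ ≤ t → 0ℚ ≤ r → 0ℚ < h → r ≤ h →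
           b < (t + r) * (t + r) → a ≤ b + h * h → s ≤ t + (h + h)
    core a b s t r h (inj₂ refl) 0≤t 0≤r 0<h r≤h b< a≤ =
      ℚ.+-mono-≤ {0ℚ} {t} {0ℚ} {h + h} 0≤t (ℚ.<⇒≤ (0<+ 0<h 0<h))
    core a b s t r h (inj₁ s²≤a) 0≤t 0≤r 0<h r≤h b< a≤ with s ℚ.≤? t + (h + h)
    ... | yes p = p
    ... | no ¬p = contradiction loop (ℚ.<-irrefl refl)
      where
      v = t + (h + h)
      0≤h = ℚ.<⇒≤ 0<h
      0≤v : 0ℚ ≤ v
      0≤v = ℚ.+-mono-≤ {0ℚ} {t} {0ℚ} {h + h} 0≤t (ℚ.<⇒≤ (0<+ 0<h 0<h))
      0≤t+r : 0ℚ ≤ t + r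
      0≤t+r = ℚ.+-mono-≤ {0ℚ} {t} {0ℚ} {r} 0≤t 0≤r
      0≤t+h : 0ℚ ≤ t + h
      0≤t+h = ℚ.+-mono-≤ {0ℚ} {t} {0ℚ} {h} 0≤t 0≤h
      v≤s = ℚ.<⇒≤ (ℚ.≰⇒> ¬p)
      t+r≤t+h = ℚ.+-monoʳ-≤ t r≤h
      eq : ∀ t h → ((t + h) * (t + h) + h * h) + ((t + h) * h + (t + h) * h) ≡ (t + (h + h)) * (t + (h + h))
      eq = solve-∀ ring
      loop : v * v < v * v
      loop = begin-strict
        v * v                      ≤⟨ ≤-* {v} {s} {v} {s} 0≤v (ℚ.≤-trans 0≤v v≤s) v≤s v≤s ⟩
        s * s                      ≤⟨ s²≤a ⟩
        a                          ≤⟨ a≤ ⟩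
        b + h * h                  <⟨ ℚ.+-monoˡ-< (h * h) b< ⟩
        (t + r) * (t + r) + h * h  ≤⟨ ℚ.+-monoˡ-≤ (h * h) (≤-* {t + r} {t + h} {t + r} {t + h} 0≤t+r 0≤t+h t+r≤t+h t+r≤t+h) ⟩
        (t + h) * (t + h) + h * h  ≡⟨ ℚ.+-identityʳ ((t + h) * (t + h) + h * h) ⟨
        ((t + h) * (t + h) + h * h) + 0ℚ
          ≤⟨ ℚ.+-monoʳ-≤ ((t + h) * (t + h) + h * h) (ℚ.+-mono-≤ {0ℚ} {(t + h) * h} {0ℚ} {(t + h) * h} (0≤* {t + h} {h} 0≤t+h 0≤h) (0≤* {t + h} {h} 0≤t+h 0≤h)) ⟩
        ((t + h) * (t + h) + h * h) + ((t + h) * h + (t + h) * h)  ≡⟨ eq t h ⟩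
        v * v                      ∎
        where open ℚ.≤-Reasoning

    cauchy : ∀ {x} → IsCauchy x → IsCauchy (λ n → sqrtApprox (x n) n)
    cauchy {x} cx ε 0<ε =
      let h = ½ * ε
          0<h = half 0<ε
          M , p = cx (h * h) (0<* 0<h 0<h)
          d , q = unit 0<h
      in M ℕ.⊔ d , λ m n N≤m N≤n →
         subst (λ e → sqrtApprox (x m) m ≤ sqrtApprox (x n) n + e) (halves ε)
           (core (x m) (x n) (sqrtApprox (x m) m) (sqrtApprox (x n) n) (+ 1 / suc n) h
             (lower (x m) m) (0≤/ (sqrtNumerator (x n) n) n) (0≤/ 1 n) 0<h (q n (ℕ.m⊔n≤o⇒n≤o M d N≤n)) (upper (x n) n)
             (p m n (ℕ.m⊔n≤o⇒m≤o M d N≤m) (ℕ.m⊔n≤o⇒m≤o M d N≤n)))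

  -- logApprox b q n approximates log_b (max 1 q) from below: it is the largest
  -- p / suc n such that b ^ (p / suc n) ≤ max 1 q.

  logNumerator : ℕ → ℚ → ℕ → ℕ
  logNumerator b q n =
    greatest (λ p → ι (b ℕ.^ p) ℚ.≤? (1ℚ ⊔ q) ^ℚ suc n) ℤ.∣ ↥ ((1ℚ ⊔ q) ^ℚ suc n) ∣

  logApprox : ℕ → ℚ → ℕ → ℚ
  logApprox b q n = + logNumerator b q n / suc n

  module Log (b : ℕ) (1<b : 1 ℕ.< b) where

    b≢0 : NonZero b
    b≢0 = ℕ.>-nonZero (ℕ.<-trans (s≤s z≤n) 1<b)

    n<b^n : ∀ n → n ℕ.< b ℕ.^ n
    n<b^n zero = s≤s z≤n
    n<b^n (suc n) = ℕ.≤-<-trans (n<b^n n) (ℕ.^-monoʳ-< b 1<b (ℕ.n<1+n n))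

    b^-cancel-≤ : ∀ {m n} → b ℕ.^ m ℕ.≤ b ℕ.^ n → m ℕ.≤ n
    b^-cancel-≤ p = ℕ.≮⇒≥ λ n<m → ℕ.<⇒≱ (ℕ.^-monoʳ-< b 1<b n<m) p

    1≤⊔ : ∀ q → 1ℚ ≤ 1ℚ ⊔ q
    1≤⊔ q = ℚ.p≤p⊔q 1ℚ q

    lower : ∀ q n → ι (b ℕ.^ logNumerator b q n) ≤ (1ℚ ⊔ q) ^ℚ suc n
    lower q n = Sum.[ (λ p → p) , (λ e → ≤-respˡ (cong (λ p → ι (b ℕ.^ p)) (sym e)) (1≤^ (suc n) (1≤⊔ q))) ]′
      (greatest-spec (λ p → ι (b ℕ.^ p) ℚ.≤? (1ℚ ⊔ q) ^ℚ suc n) ℤ.∣ ↥ ((1ℚ ⊔ q) ^ℚ suc n) ∣)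

    upper : ∀ q n → (1ℚ ⊔ q) ^ℚ suc n ≤ ι (b ℕ.^ suc (logNumerator b q n))
    upper q n = ℚ.<⇒≤ (ℚ.≰⇒> {ι (b ℕ.^ suc p)} {y} λ h →
      ℕ.<-irrefl refl (greatest-max (λ p → ι (b ℕ.^ p) ℚ.≤? y)
        (ℕ.≤-trans (ℕ.<⇒≤ (n<b^n (suc p))) (ι-cancel-≤ (ℚ.≤-trans h (≤-numerator y)))) h))
      where
      y = (1ℚ ⊔ q) ^ℚ suc n
      p = logNumerator b q n

    max-cauchy : ∀ {x} → IsCauchy x → IsCauchy (λ n → 1ℚ ⊔ x n)
    max-cauchy {x} cx ε 0<ε = let N , p = cx ε 0<ε in
      N , λ m n N≤m N≤n → ℚ.⊔-lub {(1ℚ ⊔ x n) + ε} {1ℚ} {x m}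
        (ℚ.+-mono-≤ {1ℚ} {1ℚ ⊔ x n} {0ℚ} {ε} (1≤⊔ (x n)) (ℚ.<⇒≤ 0<ε))
        (ℚ.≤-trans (p m n N≤m N≤n) (ℚ.+-monoˡ-≤ ε (ℚ.p≤q⊔p 1ℚ (x n))))

    -- (1 + η) ^ d ≤ 2 for a suitable η > 0.

    coeff : ℕ → ℕ
    coeff zero = zero
    coeff (suc d) = suc (coeff d ℕ.+ coeff d)

    ι-coeff : ∀ d → ι (coeff (suc d)) ≡ 1ℚ + (ι (coeff d) + ι (coeff d))
    ι-coeff d = trans (ι-+ 1 (coeff d ℕ.+ coeff d)) (cong (λ u → 1ℚ + u) (ι-+ (coeff d) (coeff d)))

    bernoulli : ∀ {η} d → 0ℚ ≤ η → η ≤ 1ℚ → (1ℚ + η) ^ℚ d ≤ 1ℚ + ι (coeff d) * η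
    bernoulli {η} zero 0≤η η≤1 = ℚ.≤-reflexive (sym (trans (cong (λ u → 1ℚ + u) (ℚ.*-zeroˡ η)) (ℚ.+-identityʳ 1ℚ)))
    bernoulli {η} (suc d) 0≤η η≤1 = begin
      (1ℚ + η) * (1ℚ + η) ^ℚ d                    ≤⟨ ≤-*ˡ {(1ℚ + η) ^ℚ d} {1ℚ + c * η} 0≤1+η (bernoulli d 0≤η η≤1) ⟩
      (1ℚ + η) * (1ℚ + c * η)                     ≡⟨ eq c η ⟩
      (1ℚ + (1ℚ + c) * η) + (c * η) * η           ≤⟨ ℚ.+-monoʳ-≤ (1ℚ + (1ℚ + c) * η) (≤-*ˡ {η} {1ℚ} {c * η} (0≤* {c} {η} (0≤ι (coeff d)) 0≤η) η≤1) ⟩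
      (1ℚ + (1ℚ + c) * η) + (c * η) * 1ℚ          ≡⟨ eq′ c η ⟩
      1ℚ + (1ℚ + (c + c)) * η                     ≡⟨ cong (λ u → 1ℚ + u * η) (ι-coeff d) ⟨
      1ℚ + ι (coeff (suc d)) * η                  ∎
      where
      open ℚ.≤-Reasoning
      c = ι (coeff d)
      0≤1+η : 0ℚ ≤ 1ℚ + η
      0≤1+η = ℚ.+-mono-≤ {0ℚ} {1ℚ} {0ℚ} {η} (ℚ.nonNegative⁻¹ 1ℚ) 0≤η
      eq : ∀ c η → (1ℚ + η) * (1ℚ + c * η) ≡ (1ℚ + (1ℚ + c) * η) + (c * η) * η
      eq = solve-∀ ring
      eq′ : ∀ c η → (1ℚ + (1ℚ + c) * η) + (c * η) * 1ℚ ≡ 1ℚ + (1ℚ + (c + c)) * η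
      eq′ = solve-∀ ring

    small-power : ∀ d → ∃[ η ] 0ℚ < η × (1ℚ + η) ^ℚ d ≤ ι b
    small-power d =
      let η , 0<η , e = 1/-spec (0<ι (coeff d))
          0≤η = ℚ.<⇒≤ 0<η
          η≤1 : η ≤ 1ℚ
          η≤1 = ≤-respˡ (ℚ.*-identityˡ η) (ℚ.≤-trans (≤-*ʳ {1ℚ} {ι (suc (coeff d))} {η} 0≤η (ι-mono-≤ {1} {suc (coeff d)} (s≤s z≤n))) (ℚ.≤-reflexive e))
          cη≤1 : ι (coeff d) * η ≤ 1ℚ
          cη≤1 = ℚ.≤-trans (≤-*ʳ {ι (coeff d)} {ι (suc (coeff d))} {η} 0≤η (ι-mono-≤ (ℕ.n≤1+n (coeff d)))) (ℚ.≤-reflexive e)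
      in η , 0<η , ℚ.≤-trans (bernoulli d 0≤η η≤1) (ℚ.≤-trans (ℚ.+-monoʳ-≤ 1ℚ cη≤1)
           (ℚ.≤-trans (ℚ.≤-reflexive (sym (ι-+ 1 1))) (ι-mono-≤ 1<b)))

    core : ∀ {y z η} p p′ N N′ d → 1ℚ ≤ y → 1ℚ ≤ z → 0ℚ ≤ η → y ≤ z * (1ℚ + η) → (1ℚ + η) ^ℚ d ≤ ι b →
           ι (b ℕ.^ p) ≤ y ^ℚ N → z ^ℚ N′ ≤ ι (b ℕ.^ p′) →
           p ℕ.* (N′ ℕ.* d) ℕ.≤ p′ ℕ.* (N ℕ.* d) ℕ.+ N ℕ.* N′
    core {y} {z} {η} p p′ N N′ d 1≤y 1≤z 0≤η y≤ η^d≤b lo hi = b^-cancel-≤ (ι-cancel-≤ (begin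
      ι (b ℕ.^ (p ℕ.* (N′ ℕ.* d)))                     ≡⟨ cong ι (ℕ.^-*-assoc b p (N′ ℕ.* d)) ⟨
      ι ((b ℕ.^ p) ℕ.^ (N′ ℕ.* d))                     ≡⟨ ι-^ (b ℕ.^ p) (N′ ℕ.* d) ⟩
      ι (b ℕ.^ p) ^ℚ (N′ ℕ.* d)                        ≤⟨ ^-mono (N′ ℕ.* d) (0≤ι (b ℕ.^ p)) lo ⟩
      (y ^ℚ N) ^ℚ (N′ ℕ.* d)                           ≡⟨ Exp.^-assocʳ y N (N′ ℕ.* d) ⟩
      y ^ℚ (N ℕ.* (N′ ℕ.* d))                          ≤⟨ ^-mono (N ℕ.* (N′ ℕ.* d)) (ℚ.≤-trans 0≤1 1≤y) y≤ ⟩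
      (z * w) ^ℚ (N ℕ.* (N′ ℕ.* d))                    ≡⟨ Exp.^-distrib-* z w (N ℕ.* (N′ ℕ.* d)) ⟩
      z ^ℚ (N ℕ.* (N′ ℕ.* d)) * w ^ℚ (N ℕ.* (N′ ℕ.* d))
        ≡⟨ cong₂ (λ u v → z ^ℚ u * w ^ℚ v) (swap₁ N N′ d) (swap₂ N N′ d) ⟩
      z ^ℚ (N′ ℕ.* (N ℕ.* d)) * w ^ℚ (d ℕ.* (N ℕ.* N′))
        ≡⟨ cong₂ _*_ (Exp.^-assocʳ z N′ (N ℕ.* d)) (Exp.^-assocʳ w d (N ℕ.* N′)) ⟨
      (z ^ℚ N′) ^ℚ (N ℕ.* d) * (w ^ℚ d) ^ℚ (N ℕ.* N′)
        ≤⟨ ≤-* {(z ^ℚ N′) ^ℚ (N ℕ.* d)} {ι (b ℕ.^ p′) ^ℚ (N ℕ.* d)} {(w ^ℚ d) ^ℚ (N ℕ.* N′)} {ι b ^ℚ (N ℕ.* N′)}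
             (^-nonNeg (N ℕ.* N′) (^-nonNeg d 0≤w)) (^-nonNeg (N ℕ.* d) (0≤ι (b ℕ.^ p′)))
             (^-mono (N ℕ.* d) (^-nonNeg N′ (ℚ.≤-trans 0≤1 1≤z)) hi)
             (^-mono (N ℕ.* N′) (^-nonNeg d 0≤w) η^d≤b) ⟩
      ι (b ℕ.^ p′) ^ℚ (N ℕ.* d) * ι b ^ℚ (N ℕ.* N′)    ≡⟨ cong₂ _*_ (ι-^ (b ℕ.^ p′) (N ℕ.* d)) (ι-^ b (N ℕ.* N′)) ⟨
      ι ((b ℕ.^ p′) ℕ.^ (N ℕ.* d)) * ι (b ℕ.^ (N ℕ.* N′))
        ≡⟨ ι-* ((b ℕ.^ p′) ℕ.^ (N ℕ.* d)) (b ℕ.^ (N ℕ.* N′)) ⟨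
      ι ((b ℕ.^ p′) ℕ.^ (N ℕ.* d) ℕ.* b ℕ.^ (N ℕ.* N′))
        ≡⟨ cong (λ u → ι (u ℕ.* b ℕ.^ (N ℕ.* N′))) (ℕ.^-*-assoc b p′ (N ℕ.* d)) ⟩
      ι (b ℕ.^ (p′ ℕ.* (N ℕ.* d)) ℕ.* b ℕ.^ (N ℕ.* N′))
        ≡⟨ cong ι (ℕ.^-distribˡ-+-* b (p′ ℕ.* (N ℕ.* d)) (N ℕ.* N′)) ⟨
      ι (b ℕ.^ (p′ ℕ.* (N ℕ.* d) ℕ.+ N ℕ.* N′))        ∎))
      where
      open ℚ.≤-Reasoning
      w = 1ℚ + η
      0≤1 = ℚ.nonNegative⁻¹ 1ℚ
      0≤w : 0ℚ ≤ w
      0≤w = ℚ.+-mono-≤ {0ℚ} {1ℚ} {0ℚ} {η} 0≤1 0≤η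
      swap₁ : ∀ N N′ d → N ℕ.* (N′ ℕ.* d) ≡ N′ ℕ.* (N ℕ.* d)
      swap₁ = ℕ-Solver.solve-∀
      swap₂ : ∀ N N′ d → N ℕ.* (N′ ℕ.* d) ≡ d ℕ.* (N ℕ.* N′)
      swap₂ = ℕ-Solver.solve-∀

    quotient : ∀ p p′ m n d → p ℕ.* (suc n ℕ.* suc d) ℕ.≤ suc p′ ℕ.* (suc m ℕ.* suc d) ℕ.+ suc m ℕ.* suc n →
               + p / suc m ≤ (+ p′ / suc n) + ((+ 1 / suc n) + (+ 1 / suc d))
    quotient p p′ m n d h = cancelʳ-≤ {l} {l′ + (r + s)} {M * (N * D)} (0<* {M} {N * D} (0<ι m) (0<* {N} {D} (0<ι n) (0<ι d))) (begin
      l * (M * (N * D))                                            ≡⟨ ℚ.*-assoc l M (N * D) ⟨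
      (l * M) * (N * D)                                            ≡⟨ cong₂ _*_ (/-cancel p m) (sym (ι-* (suc n) (suc d))) ⟩
      ι p * ι (suc n ℕ.* suc d)                                    ≡⟨ ι-* p (suc n ℕ.* suc d) ⟨
      ι (p ℕ.* (suc n ℕ.* suc d))                                  ≤⟨ ι-mono-≤ h ⟩
      ι (suc p′ ℕ.* (suc m ℕ.* suc d) ℕ.+ suc m ℕ.* suc n)         ≡⟨ ι-+ (suc p′ ℕ.* (suc m ℕ.* suc d)) (suc m ℕ.* suc n) ⟩
      ι (suc p′ ℕ.* (suc m ℕ.* suc d)) + ι (suc m ℕ.* suc n)
        ≡⟨ cong₂ _+_ (trans (ι-* (suc p′) (suc m ℕ.* suc d)) (cong (ι (suc p′) *_) (ι-* (suc m) (suc d)))) (ι-* (suc m) (suc n)) ⟩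
      ι (suc p′) * (M * D) + M * N                                 ≡⟨ cong (λ u → u * (M * D) + M * N) (ι-+ 1 p′) ⟩
      (ι 1 + ι p′) * (M * D) + M * N                               ≡⟨ cong₂ (λ u v → (u + v) * (M * D) + M * N) (/-cancel 1 n) (/-cancel p′ n) ⟨
      (r * N + l′ * N) * (M * D) + M * N                           ≡⟨ cong (λ u → (r * N + l′ * N) * (M * D) + u) (ℚ.*-identityˡ (M * N)) ⟨
      (r * N + l′ * N) * (M * D) + ι 1 * (M * N)                   ≡⟨ cong (λ u → (r * N + l′ * N) * (M * D) + u * (M * N)) (/-cancel 1 d) ⟨
      (r * N + l′ * N) * (M * D) + (s * D) * (M * N)               ≡⟨ eq l′ r s M N D ⟩
      (l′ + (r + s)) * (M * (N * D))                               ∎)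
      where
      open ℚ.≤-Reasoning
      l = + p / suc m
      l′ = + p′ / suc n
      r = + 1 / suc n
      s = + 1 / suc d
      M = ι (suc m)
      N = ι (suc n)
      D = ι (suc d)
      eq : ∀ l′ r s M N D → (r * N + l′ * N) * (M * D) + (s * D) * (M * N) ≡ (l′ + (r + s)) * (M * (N * D))
      eq = solve-∀ ring

    ratio : ∀ {y z η} → 1ℚ ≤ z → 0ℚ ≤ η → y ≤ z + η → y ≤ z * (1ℚ + η)
    ratio {y} {z} {η} 1≤z 0≤η y≤ = begin
      y              ≤⟨ y≤ ⟩
      z + η          ≡⟨ cong (λ u → z + u) (ℚ.*-identityˡ η) ⟨
      z + 1ℚ * η     ≤⟨ ℚ.+-monoʳ-≤ z (≤-*ʳ {1ℚ} {z} {η} 0≤η 1≤z) ⟩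
      z + z * η      ≡⟨ eq z η ⟩
      z * (1ℚ + η)   ∎
      where
      open ℚ.≤-Reasoning
      eq : ∀ z η → z + z * η ≡ z * (1ℚ + η)
      eq = solve-∀ ring

    cauchy : ∀ {x} → IsCauchy x → IsCauchy (λ n → logApprox b (x n) n)
    cauchy {x} cx ε 0<ε =
      let d , q = unit (half 0<ε)
          η , 0<η , η^d≤b = small-power (suc d)
          M , p = max-cauchy cx η 0<η
      in M ℕ.⊔ d , λ m n N≤m N≤n →
         ℚ.≤-trans
           (quotient (logNumerator b (x m) m) (logNumerator b (x n) n) m n d
             (core {1ℚ ⊔ x m} {1ℚ ⊔ x n} {η} (logNumerator b (x m) m) (suc (logNumerator b (x n) n)) (suc m) (suc n) (suc d)
               (1≤⊔ (x m)) (1≤⊔ (x n)) (ℚ.<⇒≤ 0<η)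
               (ratio {1ℚ ⊔ x m} {1ℚ ⊔ x n} {η} (1≤⊔ (x n)) (ℚ.<⇒≤ 0<η)
                 (p m n (ℕ.m⊔n≤o⇒m≤o M d N≤m) (ℕ.m⊔n≤o⇒m≤o M d N≤n)))
               η^d≤b (lower (x m) m) (upper (x n) n)))
           (ℚ.+-monoʳ-≤ (logApprox b (x n) n)
             (ℚ.≤-trans (ℚ.+-mono-≤ {+ 1 / suc n} {½ * ε} {+ 1 / suc d} {½ * ε} (q n (ℕ.m⊔n≤o⇒n≤o M d N≤n)) (q d ℕ.≤-refl))
                        (ℚ.≤-reflexive (halves ε))))

  ∑ : (ℕ → ℕ) → ℕ → ℕ
  ∑ f zero = zero
  ∑ f (suc n) = ∑ f n ℕ.+ f (suc n)

  -- The number of j ≥ 1 with i² + j² ≤ n².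

  column : ℕ → ℕ → ℕ
  column n i = greatest (λ j → i ℕ.* i ℕ.+ j ℕ.* j ℕ.≤? n ℕ.* n) n

  -- The number of points (i , j) with i, j ≥ 1 in the disc of radius n.

  quarterDisc : ℕ → ℕ
  quarterDisc n = ∑ (column n) n

  -- Four quarter discs of radius suc n, rescaled to radius 1.

  piApprox : ℕ → ℚ
  piApprox n = + (4 ℕ.* quarterDisc (suc n)) / (suc n ℕ.* suc n)

  module Pi where

    open ℕ.≤-Reasoning

    square-cancel-≤ : ∀ {i j} → i ℕ.* i ℕ.≤ j ℕ.* j → i ℕ.≤ j
    square-cancel-≤ p = ℕ.≮⇒≥ λ j<i → ℕ.<⇒≱ (ℕ.*-mono-< j<i j<i) p

    column-spec : ∀ {n i} → i ℕ.≤ n → i ℕ.* i ℕ.+ column n i ℕ.* column n i ℕ.≤ n ℕ.* n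
    column-spec {n} {i} i≤n = Sum.[ (λ p → p) , zeroCase (column n i) ]′
      (greatest-spec (λ j → i ℕ.* i ℕ.+ j ℕ.* j ℕ.≤? n ℕ.* n) n)
      where
      zeroCase : ∀ c → c ≡ 0 → i ℕ.* i ℕ.+ c ℕ.* c ℕ.≤ n ℕ.* n
      zeroCase c refl = ℕ.≤-trans (ℕ.≤-reflexive (ℕ.+-identityʳ (i ℕ.* i))) (ℕ.*-mono-≤ i≤n i≤n)

    column-max : ∀ {n i j} → i ℕ.* i ℕ.+ j ℕ.* j ℕ.≤ n ℕ.* n → j ℕ.≤ column n i
    column-max {n} {i} {j} p = greatest-max (λ j → i ℕ.* i ℕ.+ j ℕ.* j ℕ.≤? n ℕ.* n)
      (square-cancel-≤ {j} {n} (ℕ.≤-trans (ℕ.m≤n+m (j ℕ.* j) (i ℕ.* i)) p)) p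

    column≤ : ∀ n i → column n i ℕ.≤ n
    column≤ n i = greatest≤ (λ j → i ℕ.* i ℕ.+ j ℕ.* j ℕ.≤? n ℕ.* n) n

    ∑-lower : ∀ f s m L → (∀ j → j ℕ.≤ m → L ℕ.≤ f (s ℕ.+ j)) → ∑ f s ℕ.+ m ℕ.* L ℕ.≤ ∑ f (s ℕ.+ m)
    ∑-lower f s zero L h = ℕ.≤-reflexive (trans (ℕ.+-identityʳ (∑ f s)) (cong (∑ f) (sym (ℕ.+-identityʳ s))))
    ∑-lower f s (suc m) L h = begin
      ∑ f s ℕ.+ (L ℕ.+ m ℕ.* L)             ≡⟨ eq (∑ f s) L (m ℕ.* L) ⟩
      (∑ f s ℕ.+ m ℕ.* L) ℕ.+ L             ≤⟨ ℕ.+-mono-≤ (∑-lower f s m L (λ j j≤m → h j (ℕ.m≤n⇒m≤1+n j≤m))) (h (suc m) ℕ.≤-refl) ⟩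
      ∑ f (s ℕ.+ m) ℕ.+ f (s ℕ.+ suc m)     ≡⟨ cong (λ u → ∑ f (s ℕ.+ m) ℕ.+ f u) (ℕ.+-suc s m) ⟩
      ∑ f (suc (s ℕ.+ m))                   ≡⟨ cong (∑ f) (ℕ.+-suc s m) ⟨
      ∑ f (s ℕ.+ suc m)                     ∎
      where
      eq : ∀ a b c → a ℕ.+ (b ℕ.+ c) ≡ (a ℕ.+ c) ℕ.+ b
      eq = ℕ-Solver.solve-∀

    ∑-upper : ∀ f s m U → (∀ j → j ℕ.≤ m → f (s ℕ.+ j) ℕ.≤ U) → ∑ f (s ℕ.+ m) ℕ.≤ ∑ f s ℕ.+ m ℕ.* U
    ∑-upper f s zero U h = ℕ.≤-reflexive (sym (trans (ℕ.+-identityʳ (∑ f s)) (cong (∑ f) (sym (ℕ.+-identityʳ s)))))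
    ∑-upper f s (suc m) U h = begin
      ∑ f (s ℕ.+ suc m)                     ≡⟨ cong (∑ f) (ℕ.+-suc s m) ⟩
      ∑ f (suc (s ℕ.+ m))                   ≡⟨ cong (λ u → ∑ f (s ℕ.+ m) ℕ.+ f u) (ℕ.+-suc s m) ⟨
      ∑ f (s ℕ.+ m) ℕ.+ f (s ℕ.+ suc m)     ≤⟨ ℕ.+-mono-≤ (∑-upper f s m U (λ j j≤m → h j (ℕ.m≤n⇒m≤1+n j≤m))) (h (suc m) ℕ.≤-refl) ⟩
      (∑ f s ℕ.+ m ℕ.* U) ℕ.+ U             ≡⟨ eq (∑ f s) U (m ℕ.* U) ⟨
      ∑ f s ℕ.+ (U ℕ.+ m ℕ.* U)             ∎
      where
      eq : ∀ a b c → a ℕ.+ (b ℕ.+ c) ≡ (a ℕ.+ c) ℕ.+ b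
      eq = ℕ-Solver.solve-∀

    scale : ∀ m i j → (m ℕ.* i) ℕ.* (m ℕ.* i) ℕ.+ (m ℕ.* j) ℕ.* (m ℕ.* j) ≡ (m ℕ.* m) ℕ.* (i ℕ.* i ℕ.+ j ℕ.* j)
    scale = ℕ-Solver.solve-∀

    scale₁ : ∀ m n → (m ℕ.* n) ℕ.* (m ℕ.* n) ≡ (m ℕ.* m) ℕ.* (n ℕ.* n)
    scale₁ = ℕ-Solver.solve-∀

    fine-lower : ∀ n m i a → i ℕ.≤ n → a ℕ.≤ m ℕ.* i → m ℕ.* column n i ℕ.≤ column (m ℕ.* n) a
    fine-lower n m i a i≤n a≤mi = column-max {m ℕ.* n} {a} (begin
      a ℕ.* a ℕ.+ (m ℕ.* c) ℕ.* (m ℕ.* c)                    ≤⟨ ℕ.+-monoˡ-≤ ((m ℕ.* c) ℕ.* (m ℕ.* c)) (ℕ.*-mono-≤ a≤mi a≤mi) ⟩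
      (m ℕ.* i) ℕ.* (m ℕ.* i) ℕ.+ (m ℕ.* c) ℕ.* (m ℕ.* c)    ≡⟨ scale m i c ⟩
      (m ℕ.* m) ℕ.* (i ℕ.* i ℕ.+ c ℕ.* c)                    ≤⟨ ℕ.*-monoʳ-≤ (m ℕ.* m) (column-spec i≤n) ⟩
      (m ℕ.* m) ℕ.* (n ℕ.* n)                                ≡⟨ scale₁ m n ⟨
      (m ℕ.* n) ℕ.* (m ℕ.* n)                                ∎)
      where c = column n i

    fine-upper : ∀ n m i a .{{_ : NonZero m}} → m ℕ.* i ℕ.≤ a → a ℕ.≤ m ℕ.* n →
                 column (m ℕ.* n) a ℕ.≤ m ℕ.* suc (column n i)
    fine-upper n m i a mi≤a a≤mn = ℕ.≮⇒≥ λ h → ℕ.<-irrefl refl (column-max {n} {i} (ℕ.*-cancelˡ-≤ (m ℕ.* m) {{ℕ.m*n≢0 m m}} (begin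
      (m ℕ.* m) ℕ.* (i ℕ.* i ℕ.+ suc c ℕ.* suc c)                   ≡⟨ scale m i (suc c) ⟨
      (m ℕ.* i) ℕ.* (m ℕ.* i) ℕ.+ (m ℕ.* suc c) ℕ.* (m ℕ.* suc c)   ≤⟨ ℕ.+-mono-≤ (ℕ.*-mono-≤ mi≤a mi≤a) (ℕ.*-mono-≤ (ℕ.<⇒≤ h) (ℕ.<⇒≤ h)) ⟩
      a ℕ.* a ℕ.+ b ℕ.* b                                           ≤⟨ column-spec a≤mn ⟩
      (m ℕ.* n) ℕ.* (m ℕ.* n)                                       ≡⟨ scale₁ m n ⟩
      (m ℕ.* m) ℕ.* (n ℕ.* n)                                       ∎)))
      where
      c = column n i
      b = column (m ℕ.* n) a

    disc-lower : ∀ n m k → k ℕ.≤ n → (m ℕ.* m) ℕ.* ∑ (column n) k ℕ.≤ ∑ (column (m ℕ.* n)) (m ℕ.* k)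
    disc-lower n m zero k≤n = ℕ.≤-trans (ℕ.≤-reflexive (ℕ.*-zeroʳ (m ℕ.* m))) z≤n
    disc-lower n m (suc k) k<n = begin
      (m ℕ.* m) ℕ.* (S ℕ.+ c)                     ≡⟨ eq m S c ⟩
      (m ℕ.* m) ℕ.* S ℕ.+ m ℕ.* (m ℕ.* c)         ≤⟨ ℕ.+-monoˡ-≤ (m ℕ.* (m ℕ.* c)) (disc-lower n m k (ℕ.<⇒≤ k<n)) ⟩
      ∑ F (m ℕ.* k) ℕ.+ m ℕ.* (m ℕ.* c)           ≤⟨ ∑-lower F (m ℕ.* k) m (m ℕ.* c) (λ j j≤m → fine-lower n m (suc k) (m ℕ.* k ℕ.+ j) k<n
                                                       (ℕ.≤-trans (ℕ.+-monoʳ-≤ (m ℕ.* k) j≤m) (ℕ.≤-reflexive (eq′ m k)))) ⟩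
      ∑ F (m ℕ.* k ℕ.+ m)                         ≡⟨ cong (∑ F) (eq′ m k) ⟩
      ∑ F (m ℕ.* suc k)                           ∎
      where
      F = column (m ℕ.* n)
      S = ∑ (column n) k
      c = column n (suc k)
      eq : ∀ m S c → (m ℕ.* m) ℕ.* (S ℕ.+ c) ≡ (m ℕ.* m) ℕ.* S ℕ.+ m ℕ.* (m ℕ.* c)
      eq = ℕ-Solver.solve-∀
      eq′ : ∀ m k → m ℕ.* k ℕ.+ m ≡ m ℕ.* suc k
      eq′ m k = trans (ℕ.+-comm (m ℕ.* k) m) (sym (ℕ.*-suc m k))

    -- The sum of column n i + 1 over 0 ≤ i < k.

    shifted : ℕ → ℕ → ℕ
    shifted n zero = zero
    shifted n (suc k) = shifted n k ℕ.+ suc (column n k)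

    shifted≤ : ∀ n k → shifted n k ℕ.+ column n k ℕ.≤ ∑ (column n) k ℕ.+ (n ℕ.+ k)
    shifted≤ n zero = ℕ.≤-trans (column≤ n 0) (ℕ.≤-reflexive (sym (ℕ.+-identityʳ n)))
    shifted≤ n (suc k) = begin
      (shifted n k ℕ.+ suc (column n k)) ℕ.+ d    ≡⟨ eq (shifted n k) (column n k) d ⟩
      (shifted n k ℕ.+ column n k) ℕ.+ suc d      ≤⟨ ℕ.+-monoˡ-≤ (suc d) (shifted≤ n k) ⟩
      (∑ (column n) k ℕ.+ (n ℕ.+ k)) ℕ.+ suc d    ≡⟨ eq′ (∑ (column n) k) n k d ⟩
      (∑ (column n) k ℕ.+ d) ℕ.+ (n ℕ.+ suc k)    ∎
      where
      d = column n (suc k)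
      eq : ∀ s c d → (s ℕ.+ suc c) ℕ.+ d ≡ (s ℕ.+ c) ℕ.+ suc d
      eq = ℕ-Solver.solve-∀
      eq′ : ∀ S n k d → (S ℕ.+ (n ℕ.+ k)) ℕ.+ suc d ≡ (S ℕ.+ d) ℕ.+ (n ℕ.+ suc k)
      eq′ = ℕ-Solver.solve-∀

    disc-upper : ∀ n m k .{{_ : NonZero m}} → k ℕ.≤ n → ∑ (column (m ℕ.* n)) (m ℕ.* k) ℕ.≤ (m ℕ.* m) ℕ.* shifted n k
    disc-upper n m zero k≤n = ℕ.≤-trans (ℕ.≤-reflexive (cong (∑ (column (m ℕ.* n))) (ℕ.*-zeroʳ m))) z≤n
    disc-upper n m (suc k) k<n = begin
      ∑ F (m ℕ.* suc k)                                 ≡⟨ cong (∑ F) (eq′ m k) ⟨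
      ∑ F (m ℕ.* k ℕ.+ m)                               ≤⟨ ∑-upper F (m ℕ.* k) m (m ℕ.* suc c) (λ j j≤m → fine-upper n m k (m ℕ.* k ℕ.+ j)
                                                             (ℕ.m≤m+n (m ℕ.* k) j)
                                                             (ℕ.≤-trans (ℕ.+-monoʳ-≤ (m ℕ.* k) j≤m)
                                                               (ℕ.≤-trans (ℕ.≤-reflexive (eq′ m k)) (ℕ.*-monoʳ-≤ m k<n)))) ⟩
      ∑ F (m ℕ.* k) ℕ.+ m ℕ.* (m ℕ.* suc c)             ≤⟨ ℕ.+-monoˡ-≤ (m ℕ.* (m ℕ.* suc c)) (disc-upper n m k (ℕ.<⇒≤ k<n)) ⟩
      (m ℕ.* m) ℕ.* S ℕ.+ m ℕ.* (m ℕ.* suc c)           ≡⟨ eq m S (suc c) ⟨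
      (m ℕ.* m) ℕ.* (S ℕ.+ suc c)                       ∎
      where
      F = column (m ℕ.* n)
      S = shifted n k
      c = column n k
      eq : ∀ m S c → (m ℕ.* m) ℕ.* (S ℕ.+ c) ≡ (m ℕ.* m) ℕ.* S ℕ.+ m ℕ.* (m ℕ.* c)
      eq = ℕ-Solver.solve-∀
      eq′ : ∀ m k → m ℕ.* k ℕ.+ m ≡ m ℕ.* suc k
      eq′ m k = trans (ℕ.+-comm (m ℕ.* k) m) (sym (ℕ.*-suc m k))

    disc-compare : ∀ m n .{{_ : NonZero m}} →
                   (n ℕ.* n) ℕ.* quarterDisc m ℕ.≤ (m ℕ.* m) ℕ.* (quarterDisc n ℕ.+ (n ℕ.+ n))
    disc-compare m n = begin
      (n ℕ.* n) ℕ.* quarterDisc m                     ≤⟨ disc-lower m n m ℕ.≤-refl ⟩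
      ∑ (column (n ℕ.* m)) (n ℕ.* m)                  ≡⟨ cong (λ u → ∑ (column u) u) (ℕ.*-comm n m) ⟩
      ∑ (column (m ℕ.* n)) (m ℕ.* n)                  ≤⟨ disc-upper n m n ℕ.≤-refl ⟩
      (m ℕ.* m) ℕ.* shifted n n                       ≤⟨ ℕ.*-monoʳ-≤ (m ℕ.* m) (ℕ.m+n≤o⇒m≤o (shifted n n) (shifted≤ n n)) ⟩
      (m ℕ.* m) ℕ.* (quarterDisc n ℕ.+ (n ℕ.+ n))     ∎

    compare : ∀ {ε} m n → ι 8 ≤ ε * ι (suc n) → piApprox m ≤ piApprox n + ε
    compare {ε} m n h = cancelʳ-≤ {l} {l′ + ε} {(M * M) * (N * N)}
      (0<* {M * M} {N * N} (0<* {M} {M} (0<ι m) (0<ι m)) (0<* {N} {N} (0<ι n) (0<ι n))) (ℚ.≤-trans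
        (ℚ.≤-reflexive (trans (sym (ℚ.*-assoc l (M * M) (N * N))) (trans (cong₂ _*_ (spec m) (sym (ι-* (suc n) (suc n)))) (sym (ι-* (4 ℕ.* c) (suc n ℕ.* suc n))))))
        (ℚ.≤-trans (ι-mono-≤ nat) (ℚ.≤-trans (ℚ.≤-reflexive split)
        (ℚ.≤-trans (ℚ.+-monoʳ-≤ ((M * M) * (l′ * (N * N))) (≤-*ˡ {ι 8 * N} {(ε * N) * N} {M * M} (0≤* {M} {M} (0≤ι (suc m)) (0≤ι (suc m))) (≤-*ʳ {ι 8} {ε * N} {N} (0≤ι (suc n)) h)))
        (ℚ.≤-reflexive (eq l′ ε M N))))))
      where
      l = piApprox m
      l′ = piApprox n
      M = ι (suc m)
      N = ι (suc n)
      c = quarterDisc (suc m)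
      c′ = quarterDisc (suc n)
      spec : ∀ n → piApprox n * (ι (suc n) * ι (suc n)) ≡ ι (4 ℕ.* quarterDisc (suc n))
      spec n = trans (cong (piApprox n *_) (sym (ι-* (suc n) (suc n)))) (/-cancel (4 ℕ.* quarterDisc (suc n)) (n ℕ.+ n ℕ.* suc n))
      arr : ∀ m n c′ → 4 ℕ.* ((m ℕ.* m) ℕ.* (c′ ℕ.+ (n ℕ.+ n))) ≡ (m ℕ.* m) ℕ.* (4 ℕ.* c′) ℕ.+ (m ℕ.* m) ℕ.* (8 ℕ.* n)
      arr = ℕ-Solver.solve-∀
      arr′ : ∀ n c → (4 ℕ.* c) ℕ.* (n ℕ.* n) ≡ 4 ℕ.* ((n ℕ.* n) ℕ.* c)
      arr′ = ℕ-Solver.solve-∀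
      nat : (4 ℕ.* c) ℕ.* (suc n ℕ.* suc n) ℕ.≤ (suc m ℕ.* suc m) ℕ.* (4 ℕ.* c′) ℕ.+ (suc m ℕ.* suc m) ℕ.* (8 ℕ.* suc n)
      nat = ℕ.≤-trans (ℕ.≤-reflexive (arr′ (suc n) c)) (ℕ.≤-trans (ℕ.*-monoʳ-≤ 4 (disc-compare (suc m) (suc n))) (ℕ.≤-reflexive (arr (suc m) (suc n) c′)))
      split : ι ((suc m ℕ.* suc m) ℕ.* (4 ℕ.* c′) ℕ.+ (suc m ℕ.* suc m) ℕ.* (8 ℕ.* suc n)) ≡ (M * M) * (l′ * (N * N)) + (M * M) * (ι 8 * N)
      split = trans (ι-+ ((suc m ℕ.* suc m) ℕ.* (4 ℕ.* c′)) ((suc m ℕ.* suc m) ℕ.* (8 ℕ.* suc n)))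
        (cong₂ _+_ (trans (ι-* (suc m ℕ.* suc m) (4 ℕ.* c′)) (cong₂ _*_ (ι-* (suc m) (suc m)) (sym (spec n))))
                   (trans (ι-* (suc m ℕ.* suc m) (8 ℕ.* suc n)) (cong₂ _*_ (ι-* (suc m) (suc m)) (ι-* 8 (suc n)))))
      eq : ∀ l ε M N → (M * M) * (l * (N * N)) + (M * M) * ((ε * N) * N) ≡ (l + ε) * ((M * M) * (N * N))
      eq = solve-∀ ring

    eighth : ∀ {ε} → 0ℚ < ε → ∃[ d ] ∀ n → d ℕ.≤ n → ι 8 ≤ ε * ι (suc n)
    eighth {ε} 0<ε = let r , 0<r , e = 1/-spec (0<ι 7)
                         d , p = arch (0<* 0<ε 0<r)
                     in d , λ n d≤n → ℚ.≤-trans (ℚ.≤-reflexive (sym (ℚ.*-identityʳ (ι 8))))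
                          (ℚ.≤-trans (≤-*ˡ {1ℚ} {(ε * r) * ι (suc n)} {ι 8} (0≤ι 8) (p n d≤n))
                          (ℚ.≤-reflexive (trans (eq (ι 8) ε r (ι (suc n))) (trans (cong (_* (ε * ι (suc n))) e) (ℚ.*-identityˡ (ε * ι (suc n)))))))
      where
      eq : ∀ a b c d → a * ((b * c) * d) ≡ (a * c) * (b * d)
      eq = solve-∀ ring

    cauchy : IsCauchy piApprox
    cauchy ε 0<ε = let d , p = eighth 0<ε in d , λ m n _ d≤n → compare m n (p n d≤n)

    piApprox-1 : piApprox 1 ≡ 1ℚ
    piApprox-1 = refl

    positive : ∃[ N ] ∀ n → N ℕ.≤ n → ½ ≤ piApprox n
    positive = let d , p = eighth 0<½ in d , λ n d≤n →
      subst (½ ≤_) (eq (piApprox n)) (ℚ.+-monoˡ-≤ (- ½) (≤-respˡ piApprox-1 (compare 1 n (p n d≤n))))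
      where
      eq : ∀ q → (q + ½) - ½ ≡ q
      eq = solve-∀ ring

  module Log₂ where

    open Log 2 (s≤s (s≤s z≤n)) using (lower; 1≤⊔; n<b^n)

    numerator≥ : ∀ n i → 2 ℕ.≤ n → suc i ℕ.≤ logNumerator 2 (ι n) i
    numerator≥ n i 2≤n = greatest-max (λ p → ι (2 ℕ.^ p) ℚ.≤? (1ℚ ⊔ ι n) ^ℚ suc i)
      (ℕ.≤-trans (ℕ.<⇒≤ (n<b^n (suc i))) (ι-cancel-≤ (ℚ.≤-trans 2^≤ (≤-numerator ((1ℚ ⊔ ι n) ^ℚ suc i))))) 2^≤
      where
      2^≤ : ι (2 ℕ.^ suc i) ≤ (1ℚ ⊔ ι n) ^ℚ suc i
      2^≤ = ≤-respˡ (sym (ι-^ 2 (suc i))) (^-mono (suc i) (0≤ι 2) (ℚ.≤-trans (ι-mono-≤ 2≤n) (ℚ.p≤q⊔p 1ℚ (ι n))))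

    numerator-zero : ∀ q i → q ≤ 1ℚ → logNumerator 2 q i ≡ 0
    numerator-zero q i q≤1 = ℕ.n<1⇒n≡0 (ℕ.<-≤-trans (n<b^n (logNumerator 2 q i)) (ι-cancel-≤ (ℚ.≤-trans (lower q i)
      (ℚ.≤-trans (^-mono (suc i) (ℚ.≤-trans (ℚ.nonNegative⁻¹ 1ℚ) (1≤⊔ q)) (ℚ.⊔-lub {1ℚ} {1ℚ} {q} ℚ.≤-refl q≤1))
        (ℚ.≤-reflexive (Exp-1 (suc i)))))))
      where
      Exp-1 : ∀ n → 1ℚ ^ℚ n ≡ 1ℚ
      Exp-1 zero = refl
      Exp-1 (suc n) = trans (ℚ.*-identityˡ (1ℚ ^ℚ n)) (Exp-1 n)

    recip≤1 : ∀ q → 1ℚ ≤ q → Cauchy.recip q ≤ 1ℚ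
    recip≤1 q 1≤q = ≤-respˡ (ℚ.*-identityˡ (Cauchy.recip q)) (ℚ.≤-trans (≤-*ʳ {1ℚ} {q} {Cauchy.recip q} (ℚ.<⇒≤ (Cauchy.recip-pos 0<q)) 1≤q)
      (ℚ.≤-reflexive (Cauchy.recip-inverse 0<q)))
      where
      0<q = ℚ.<-≤-trans (ℚ.positive⁻¹ 1ℚ) 1≤q

    1≤log : ∀ n i → 2 ℕ.≤ n → 1ℚ ≤ logApprox 2 (ι n) i - logApprox 2 (Cauchy.recip (ι n)) i
    1≤log n i 2≤n = main (logNumerator 2 (ι n) i) (logNumerator 2 (Cauchy.recip (ι n)) i) (numerator≥ n i 2≤n)
      (numerator-zero (Cauchy.recip (ι n)) i (recip≤1 (ι n) (ι-mono-≤ {1} (ℕ.<⇒≤ 2≤n))))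
      where
      main : ∀ p p′ → suc i ℕ.≤ p → p′ ≡ 0 → 1ℚ ≤ (+ p / suc i) - (+ p′ / suc i)
      main p .0 i<p refl = cancelʳ-≤ {1ℚ} {(+ p / suc i) - (+ 0 / suc i)} {ι (suc i)} (0<ι i)
        (ℚ.≤-trans (ℚ.≤-reflexive (ℚ.*-identityˡ (ι (suc i)))) (ℚ.≤-trans (ι-mono-≤ i<p) (ℚ.≤-reflexive (sym
          (trans (cong (λ z → ((+ p / suc i) - z) * ι (suc i)) (ℚ.0/n≡0 (suc i)))
          (trans (cong (_* ι (suc i)) (ℚ.+-identityʳ (+ p / suc i))) (/-cancel p i)))))))

open Sequence using (IsCauchy; module Cauchy; sqrtApprox; module Sqrt; logApprox; module Log; piApprox; module Pi)

-- Two sequences denote the same real number x ≈ y when x ≤ y and y ≤ x, for _≤_ below.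

record ℝ : Set where
  no-eta-equality
  field
    seq    : ℕ → ℚ
    cauchy : IsCauchy seq

open ℝ public

infix  4 _≤_
infixl 6 _+_ _-_
infixl 7 _*_ _/_
infix  8 -_ √_
infix  9 _⁻¹

_≤_ : ℝ → ℝ → Set
x ≤ y = ∀ ε → 0ℚ ℚ.< ε → ∃[ N ] ∀ n → N ℕ.≤ n → seq x n ℚ.≤ seq y n ℚ.+ ε

fromℚ : ℚ → ℝ
seq    (fromℚ q) _ = q
cauchy (fromℚ q)   = Cauchy.const q

fromℕ : ℕ → ℝ
fromℕ n = fromℚ (fromℤ (+ n))

_+_ : ℝ → ℝ → ℝ
seq    (x + y) n = seq x n ℚ.+ seq y n
cauchy (x + y)   = Cauchy.add (cauchy x) (cauchy y)

-_ : ℝ → ℝ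
seq    (- x) n = ℚ.- seq x n
cauchy (- x)   = Cauchy.neg (cauchy x)

_-_ : ℝ → ℝ → ℝ
x - y = x + - y

_*_ : ℝ → ℝ → ℝ
seq    (x * y) n = seq x n ℚ.* seq y n
cauchy (x * y)   = Cauchy.mul {seq x} {seq y} (cauchy x) (cauchy y)

record Positive (x : ℝ) : Set where
  field
    lowerBound  : ℚ
    lowerBound>0 : 0ℚ ℚ.< lowerBound
    eventually  : ∃[ N ] ∀ n → N ℕ.≤ n → lowerBound ℚ.≤ seq x n

open Positive

_⁻¹ : (x : ℝ) {{_ : Positive x}} → ℝ
seq    (x ⁻¹)       n = Cauchy.recip (seq x n)
cauchy (_⁻¹ x {{p}})  = Cauchy.inv {seq x} {lowerBound p} (cauchy x) (lowerBound>0 p) (eventually p)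

_/_ : (x y : ℝ) {{_ : Positive y}} → ℝ
x / y = x * y ⁻¹

-- The square root of max 0 x.

√_ : ℝ → ℝ
seq    (√ x) n = sqrtApprox (seq x n) n
cauchy (√ x)   = Sqrt.cauchy (cauchy x)

-- The area of the unit disc, as a limit of lattice point counts.

π : ℝ
seq    π = piApprox
cauchy π = Pi.cauchy

-- log⁺ b x is log_b (max 1 x), and log_b x = log_b (max 1 x) - log_b (max 1 (1 / x)).

log⁺ : (b : ℕ) .{{_ : NonTrivial b}} → ℝ → ℝ
seq    (log⁺ b x) n = logApprox b (seq x n) n
cauchy (log⁺ b x)   = Log.cauchy b (ℕ.nonTrivial⇒n>1 b) (cauchy x)

log : (b : ℕ) .{{_ : NonTrivial b}} (x : ℝ) {{_ : Positive x}} → ℝ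
seq    (log b x) = seq    (log⁺ b x - log⁺ b (x ⁻¹))
cauchy (log b x) = cauchy (log⁺ b x - log⁺ b (x ⁻¹))

module Positivity where

  open Rational using (ι; 0<ι; 0<*; 0<+; ≤-*; ≤-*ˡ; cancelʳ-≤; 0<½; 1/-spec; ≤∣∣)

  instance

    fromℕ-positive : ∀ {n} .{{_ : NonZero n}} → Positive (fromℕ n)
    fromℕ-positive {suc n} = record
      { lowerBound   = ι (suc n)
      ; lowerBound>0 = 0<ι n
      ; eventually   = 0 , λ _ _ → ℚ.≤-refl
      }

    +-positive : ∀ {x y} {{_ : Positive x}} {{_ : Positive y}} → Positive (x + y)
    +-positive {x} {y} {{p}} {{q}} = record
      { lowerBound   = lowerBound p ℚ.+ lowerBound q
      ; lowerBound>0 = 0<+ (lowerBound>0 p) (lowerBound>0 q)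
      ; eventually   = let M , f = eventually p
                           N , g = eventually q
                       in M ℕ.⊔ N , λ n h → ℚ.+-mono-≤ (f n (ℕ.m⊔n≤o⇒m≤o M N h)) (g n (ℕ.m⊔n≤o⇒n≤o M N h))
      }

    *-positive : ∀ {x y} {{_ : Positive x}} {{_ : Positive y}} → Positive (x * y)
    *-positive {x} {y} {{p}} {{q}} = record
      { lowerBound   = lowerBound p ℚ.* lowerBound q
      ; lowerBound>0 = 0<* (lowerBound>0 p) (lowerBound>0 q)
      ; eventually   = let M , f = eventually p
                           N , g = eventually q
                       in M ℕ.⊔ N , λ n h →
                         ≤-* {lowerBound p} {seq x n} {lowerBound q} {seq y n} (ℚ.<⇒≤ (lowerBound>0 q))
                           (ℚ.≤-trans (ℚ.<⇒≤ (lowerBound>0 p)) (f n (ℕ.m⊔n≤o⇒m≤o M N h)))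
                           (f n (ℕ.m⊔n≤o⇒m≤o M N h)) (g n (ℕ.m⊔n≤o⇒n≤o M N h))
      }

    ⁻¹-positive : ∀ {x} {{_ : Positive x}} → Positive (x ⁻¹)
    ⁻¹-positive {x} {{p}} =
      let B , 0<B , M , f = Cauchy.bounded (cauchy x)
          N , g = eventually p
          r , 0<r , e = 1/-spec 0<B
      in record
      { lowerBound   = r
      ; lowerBound>0 = 0<r
      ; eventually   = M ℕ.⊔ N , λ n h →
          inverse-bound B r (seq x n) 0<r e (ℚ.≤-trans (≤∣∣ (seq x n)) (f n (ℕ.m⊔n≤o⇒m≤o M N h)))
            (ℚ.<-≤-trans (lowerBound>0 p) (g n (ℕ.m⊔n≤o⇒n≤o M N h)))
      }
      where
      inverse-bound : ∀ B r q → 0ℚ ℚ.< r → B ℚ.* r ≡ 1ℚ → q ℚ.≤ B → 0ℚ ℚ.< q → r ℚ.≤ Cauchy.recip q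
      inverse-bound B r q 0<r e q≤B 0<q = cancelʳ-≤ {r} {Cauchy.recip q} {q} 0<q
        (ℚ.≤-trans (≤-*ˡ {q} {B} {r} (ℚ.<⇒≤ 0<r) q≤B)
          (ℚ.≤-reflexive (trans (ℚ.*-comm r B) (trans e (sym (trans (ℚ.*-comm (Cauchy.recip q) q) (Cauchy.recip-inverse 0<q)))))))

    π-positive : Positive π
    π-positive = record { lowerBound = ½ ; lowerBound>0 = 0<½ ; eventually = Pi.positive }

    log₂-positive : ∀ {n} .{{_ : NonTrivial n}} {p : Positive (fromℕ n)} → Positive (log 2 (fromℕ n) {{p}})
    log₂-positive {n} = record
      { lowerBound   = 1ℚ
      ; lowerBound>0 = ℚ.positive⁻¹ 1ℚ
      ; eventually   = 0 , λ i _ → Sequence.Log₂.1≤log n i (ℕ.nonTrivial⇒n>1 n)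
      }

    suc-nonTrivial : ∀ {k} .{{_ : NonZero k}} → NonTrivial (suc k)
    suc-nonTrivial {suc k} = _

open Positivity public

-- e m → 0 as m → ∞.

Vanishes : (ℕ → ℝ) → Set
Vanishes e = ∀ ε → 0ℚ ℚ.< ε → ∃[ N ] ∀ m → N ℕ.≤ m → - fromℚ ε ≤ e m × e m ≤ fromℚ ε

∑ℤ : List ℤ → ℤ
∑ℤ = foldr ℤ._+_ 0ℤ

-- xs contains the finitely many s ∈ S whose coefficient ε s is nonzero; the values of ε
-- elsewhere are irrelevant.

Is𝒟 : ℕ → Pred ℕ 0ℓ → Set
Is𝒟 k S = ∀ (xs : List ℕ) (ε : ℕ → ℤ) → Unique xs → All S xs →
          All (λ s → ℤ.∣ ε s ∣ ℕ.≤ k) xs →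
          ∑ℤ (map (λ s → ε s ℤ.* + s) xs) ≡ 0ℤ →
          All (λ s → ε s ≡ 0ℤ) xs

Image : ∀ {m} → (Fin m → ℕ) → Pred ℕ 0ℓ
Image a s = ∃[ i ] a i ≡ s

_∩[1,_] : Pred ℕ 0ℓ → ℕ → Pred ℕ 0ℓ
(S ∩[1, n ]) s = S s × 1 ℕ.≤ s × s ℕ.≤ n

-- A relation, since membership in P is not assumed to be decidable.

_HasSize_ : Pred ℕ 0ℓ → ℕ → Set
P HasSize c = ∃[ xs ] Unique xs × (∀ s → s ∈ xs ⇔ P s) × length xs ≡ c

{-# OPTIONS --safe #-}

-- The (k+1)^m sums Σ cᵢ aᵢ with digits 0 ≤ cᵢ ≤ k are distinct integers, so their variance is at
-- least that of {1,…,(k+1)^m}, namely ((k+1)^2m − 1)/12; it equals k(k+2)/12 · Σ aᵢ², since the digits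
-- are independent.  Hence (k+1)^2m ≤ 1 + k(k+2) m a_m².  This exceeds the claimed bound by the constant
-- factor 2√(π/6) > 1, so the o(1) in the first estimate can be taken to be 0.  For the second,
-- the same slack absorbs the passage from |S(n)| to log₂ n once n ≥ 512.

module Submission where

-- For n entries with sum s and square sum q, n q - s² is the sum of the squared differences over
-- all pairs. This makes the extremal variance accessible to induction in ℕ, one least element at a
-- time. The second estimate is a bootstrap. Let c be the count. The variance bound gives (k+1)^(2c)
-- ≤ k(k+2) (c+1) n², and taking logarithms leaves c + 1 to be compared with (2π/3) log₂ n. As π ≥
-- 9/4, it is enough that c + 1 ≤ (3/2) log₂ n. This follows from the variance bound once more: for
-- every k it implies 4^(c-1) ≤ c n², so c exceeds log₂ n by at most 1 + ½ log₂ c, which the margin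
-- ½ log₂ n outweighs once c > 12. If c ≤ 12, n ≥ 512 makes the comparison hold directly. Hence the
-- error term depends neither on k nor on S.

module Combinatorics where

  open import Defs using (Is𝒟; ∑ℤ)
  open import Data.Integer.Base as ℤ using (ℤ; +_; 0ℤ)
  import Data.Integer.Properties as ℤ
  import Data.Integer.Tactic.RingSolver as ℤ-Solver
  open import Data.List.Base using (List; []; _∷_; _++_; map; length)
  import Data.List.Properties as List
  open import Data.List.Membership.Propositional using (_∈_)
  open import Data.List.Membership.Propositional.Properties using (∈-++⁻; ∈-map⁻)
  open import Data.List.Relation.Binary.Permutation.Propositional using (↭⇒↭ₛ; ↭-sym)
  import Data.List.Relation.Binary.Permutation.Propositional.Properties as Perm
  import Data.List.Relation.Binary.Permutation.Setoid.Properties as SetoidPerm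
  open import Data.List.Relation.Unary.All as All using (All; []; _∷_)
  open import Data.List.Relation.Unary.AllPairs as AllPairs using (AllPairs; []; _∷_)
  open import Data.List.Relation.Unary.Any using (here)
  import Data.List.Relation.Unary.Sorted.TotalOrder.Properties as Sorted
  open import Data.List.Relation.Unary.Unique.Propositional using (Unique)
  import Data.List.Relation.Unary.Unique.Propositional.Properties as Unique
  import Data.List.Sort as Sort
  open import Data.Nat.Base as ℕ using (ℕ; zero; suc; _^_; NonZero; _≤_; _<_; z≤n; s≤s)
  open import Data.Nat.ListAction using (sum)
  open import Data.Nat.ListAction.Properties using (sum-++; sum-↭)
  import Data.Nat.Properties as ℕ
  import Data.Nat.Tactic.RingSolver as ℕ-Solver
  open import Data.Product.Base using (_×_; _,_; ∃-syntax)
  open import Data.Sum.Base using (inj₁; inj₂)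
  open import Level using (0ℓ)
  open import Relation.Binary.PropositionalEquality
  open import Relation.Nullary using (yes; no; contradiction)
  open import Relation.Unary using (Pred)

  -- The least variance of distinct integers.

  sumSq : List ℕ → ℕ
  sumSq xs = sum (map (λ x → x ℕ.* x) xs)

  module Spread where
    open import Data.Nat.Base using (_+_; _*_)
    open ℕ.≤-Reasoning

    -- This is (z - x)² ≥ j² with the cross term moved to the left, so that no truncated subtraction
    -- occurs.
    separated-squares : ∀ x j {z} → x + j ≤ z → 2 * (x * z) + j * j ≤ z * z + x * x
    separated-squares x j {z} x+j≤z with ℕ.m≤n⇒∃[o]m+o≡n x+j≤z
    ... | d , refl = begin
      2 * (x * (x + j + d)) + j * j                      ≤⟨ ℕ.m≤m+n _ (d * d + 2 * (j * d)) ⟩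
      2 * (x * (x + j + d)) + j * j + (d * d + 2 * (j * d))  ≡⟨ eq x j d ⟩
      (x + j + d) * (x + j + d) + x * x                  ∎
      where
      eq : ∀ x j d → 2 * (x * (x + j + d)) + j * j + (d * d + 2 * (j * d)) ≡ (x + j + d) * (x + j + d) + x * x
      eq = ℕ-Solver.solve-∀

    -- 6 ((j + 1)² + ⋯ + (j + n)²)
    sixSquares : ℕ → ℕ → ℕ
    sixSquares j n = 6 * (n * (j * j)) + 6 * (j * (n * suc n)) + n * suc n * suc (2 * n)

    -- Entry number i of the increasing list `zs` exceeds x by at least j + i, so the squared gaps
    -- add up to at least (j+1)² + ⋯ + (j+n)². The offset j grows by one as the induction passes to
    -- the tail.
    separated-sumSq : ∀ x j zs → AllPairs _<_ zs → All (x + j <_) zs →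
                      12 * (x * sum zs) + sixSquares j (length zs) ≤ 6 * (sumSq zs + length zs * (x * x))
    separated-sumSq x j [] [] [] = ℕ.≤-reflexive (eq x j)
      where
      eq : ∀ x j → 12 * (x * 0) + (6 * (0 * (j * j)) + 6 * (j * (0 * 1)) + 0 * 1 * 1) ≡ 0
      eq = ℕ-Solver.solve-∀
    separated-sumSq x j (z ∷ zs) (z<zs ∷ zs↗) (x+j<z ∷ _) = begin
      12 * (x * (z + s)) + sixSquares j (suc n)
        ≡⟨ eq x j z s n ⟩
      6 * (2 * (x * z) + suc j * suc j) + (12 * (x * s) + sixSquares (suc j) n)
        ≤⟨ ℕ.+-mono-≤ (ℕ.*-monoʳ-≤ 6 (separated-squares x (suc j) x+1+j≤z))
             (separated-sumSq x (suc j) zs zs↗ (All.map (ℕ.≤-<-trans x+1+j≤z) z<zs)) ⟩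
      6 * (z * z + x * x) + 6 * (q + n * (x * x))
        ≡⟨ eq′ x z q n ⟩
      6 * (z * z + q + suc n * (x * x)) ∎
      where
      s = sum zs
      q = sumSq zs
      n = length zs
      x+1+j≤z : x + suc j ≤ z
      x+1+j≤z = ℕ.≤-trans (ℕ.≤-reflexive (ℕ.+-suc x j)) x+j<z
      eq : ∀ x j z s n → 12 * (x * (z + s)) + (6 * (suc n * (j * j)) + 6 * (j * (suc n * suc (suc n))) + suc n * suc (suc n) * suc (2 * suc n)) ≡
        6 * (2 * (x * z) + suc j * suc j) + (12 * (x * s) + (6 * (n * (suc j * suc j)) + 6 * (suc j * (n * suc n)) + n * suc n * suc (2 * n)))
      eq = ℕ-Solver.solve-∀
      eq′ : ∀ x z q n → 6 * (z * z + x * x) + 6 * (q + n * (x * x)) ≡ 6 * (z * z + q + suc n * (x * x))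
      eq′ = ℕ-Solver.solve-∀

    -- In the sum of squared differences over pairs, a new least element x contributes the sum of (z
    -- - x)², which `separated-sumSq` bounds at j = 0. Consecutive integers attain equality.
    increasing-spread : ∀ xs → AllPairs _<_ xs → let n = length xs in
      12 * (sum xs * sum xs) + n * n * (n * n) ≤ 12 * (n * sumSq xs) + n * n
    increasing-spread [] [] = z≤n
    increasing-spread (x ∷ xs) (x<xs ∷ xs↗) = begin
      12 * ((x + s) * (x + s)) + suc n * suc n * (suc n * suc n)
        ≡⟨ eq x s n ⟩
      (12 * (s * s) + n * n * (n * n)) + 2 * (12 * (x * s) + sixSquares 0 n) + (12 * (x * x) + 2 * n + 1)
        ≤⟨ ℕ.+-monoˡ-≤ (12 * (x * x) + 2 * n + 1) (ℕ.+-mono-≤ (increasing-spread xs xs↗)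
             (ℕ.*-monoʳ-≤ 2 (separated-sumSq x 0 xs xs↗ (All.map (ℕ.≤-<-trans (ℕ.≤-reflexive (ℕ.+-identityʳ x))) x<xs)))) ⟩
      (12 * (n * q) + n * n) + 2 * (6 * (q + n * (x * x))) + (12 * (x * x) + 2 * n + 1)
        ≡⟨ eq′ x q n ⟩
      12 * (suc n * (x * x + q)) + suc n * suc n ∎
      where
      s = sum xs
      q = sumSq xs
      n = length xs
      eq : ∀ x s n → 12 * ((x + s) * (x + s)) + suc n * suc n * (suc n * suc n) ≡
           (12 * (s * s) + n * n * (n * n)) + 2 * (12 * (x * s) + (6 * (n * (0 * 0)) + 6 * (0 * (n * suc n)) + n * suc n * suc (2 * n))) + (12 * (x * x) + 2 * n + 1)
      eq = ℕ-Solver.solve-∀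
      eq′ : ∀ x q n → (12 * (n * q) + n * n) + 2 * (6 * (q + n * (x * x))) + (12 * (x * x) + 2 * n + 1) ≡
            12 * (suc n * (x * x + q)) + suc n * suc n
      eq′ = ℕ-Solver.solve-∀

    open Sort ℕ.≤-decTotalOrder using (sort; sort-↭; sort-↗)

    -- Sum, square sum and length do not change under sorting, and a sorted list without repetitions
    -- is strictly increasing.
    unique-spread : ∀ xs → Unique xs → let n = length xs in
      12 * (sum xs * sum xs) + n * n * (n * n) ≤ 12 * (n * sumSq xs) + n * n
    unique-spread xs xs! = go (sum-↭ p) (sum-↭ (Perm.map⁺ (λ x → x * x) p)) (Perm.↭-length p) (increasing-spread ys ys↗)
      where
      ys = sort xs
      p = sort-↭ xs
      ys↗ : AllPairs _<_ ys
      ys↗ = AllPairs.zipWith (λ (x≤y , x≢y) → ℕ.≤∧≢⇒< x≤y x≢y)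
        ( Sorted.Sorted⇒AllPairs ℕ.≤-totalOrder (sort-↗ xs)
        , SetoidPerm.Unique-resp-↭ (setoid ℕ) (↭⇒↭ₛ (↭-sym p)) xs!)
      go : ∀ {s s′ q q′ n n′} → s ≡ s′ → q ≡ q′ → n ≡ n′ →
           12 * (s * s) + n * n * (n * n) ≤ 12 * (n * q) + n * n →
           12 * (s′ * s′) + n′ * n′ * (n′ * n′) ≤ 12 * (n′ * q′) + n′ * n′
      go refl refl refl h = h

  open Spread using (unique-spread)

  -- Digit sums and their first two moments.

  shifts : ℕ → ℕ → List ℕ → List ℕ
  shifts a zero xs = xs
  shifts a (suc j) xs = xs ++ map (a ℕ.+_) (shifts a j xs)

  -- The sums Σ cᵢ aᵢ with 0 ≤ cᵢ ≤ k are listed with repetitions, so the moment formulas hold for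
  -- any list and distinctness is a separate matter.
  subsums : ℕ → List ℕ → List ℕ
  subsums k [] = 0 ∷ []
  subsums k (a ∷ as) = shifts a k (subsums k as)

  module Moments where
    open import Data.Nat.Base using (_+_; _*_)
    open ≡-Reasoning

    sum-translate : ∀ a xs → sum (map (a ℕ.+_) xs) ≡ length xs * a + sum xs
    sum-translate a [] = refl
    sum-translate a (x ∷ xs) = trans (cong (a + x ℕ.+_) (sum-translate a xs)) (eq a x (length xs * a) (sum xs))
      where
      eq : ∀ a x t s → a + x + (t + s) ≡ a + t + (x + s)
      eq = ℕ-Solver.solve-∀

    sumSq-translate : ∀ a xs → sumSq (map (a ℕ.+_) xs) ≡ sumSq xs + 2 * (a * sum xs) + length xs * (a * a)
    sumSq-translate a [] = cong (λ u → 2 * u + 0) (sym (ℕ.*-zeroʳ a))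
    sumSq-translate a (x ∷ xs) = trans (cong ((a + x) * (a + x) ℕ.+_) (sumSq-translate a xs)) (eq a x (sumSq xs) (sum xs) (length xs))
      where
      eq : ∀ a x q s n → (a + x) * (a + x) + (q + 2 * (a * s) + n * (a * a)) ≡ (x * x + q) + 2 * (a * (x + s)) + suc n * (a * a)
      eq = ℕ-Solver.solve-∀

    length-shifts : ∀ a j xs → length (shifts a j xs) ≡ suc j * length xs
    length-shifts a zero xs = sym (ℕ.+-identityʳ (length xs))
    length-shifts a (suc j) xs = trans (List.length-++ xs)
      (cong (length xs ℕ.+_) (trans (List.length-map (a ℕ.+_) (shifts a j xs)) (length-shifts a j xs)))

    -- The factor 2 clears the denominator in 0 + 1 + ⋯ + j = j (j + 1) / 2.
    sum-shifts : ∀ a j xs → 2 * sum (shifts a j xs) ≡ suc j * (2 * sum xs + a * j * length xs)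
    sum-shifts a zero xs = eq a (sum xs) (length xs)
      where
      eq : ∀ a s n → 2 * s ≡ 1 * (2 * s + a * 0 * n)
      eq = ℕ-Solver.solve-∀
    sum-shifts a (suc j) xs = begin
      2 * sum (xs ++ map (a ℕ.+_) ys)          ≡⟨ cong (2 *_) (sum-++ xs (map (a ℕ.+_) ys)) ⟩
      2 * (s + sum (map (a ℕ.+_) ys))          ≡⟨ cong (λ u → 2 * (s + u)) (sum-translate a ys) ⟩
      2 * (s + (length ys * a + sum ys))     ≡⟨ cong (λ u → 2 * (s + (u * a + sum ys))) (length-shifts a j xs) ⟩
      2 * (s + (suc j * n * a + sum ys))     ≡⟨ eq a j s n (sum ys) ⟩
      2 * s + 2 * (suc j * n * a) + 2 * sum ys   ≡⟨ cong (2 * s + 2 * (suc j * n * a) ℕ.+_) (sum-shifts a j xs) ⟩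
      2 * s + 2 * (suc j * n * a) + suc j * (2 * s + a * j * n)   ≡⟨ eq′ a j s n ⟩
      suc (suc j) * (2 * s + a * suc j * n)  ∎
      where
      ys = shifts a j xs
      s = sum xs
      n = length xs
      eq : ∀ a j s n t → 2 * (s + (suc j * n * a + t)) ≡ 2 * s + 2 * (suc j * n * a) + 2 * t
      eq = ℕ-Solver.solve-∀
      eq′ : ∀ a j s n → 2 * s + 2 * (suc j * n * a) + suc j * (2 * s + a * j * n) ≡ suc (suc j) * (2 * s + a * suc j * n)
      eq′ = ℕ-Solver.solve-∀

    -- The factor 6 clears the denominator in 1² + ⋯ + j² = j (j + 1) (2j + 1) / 6, the coefficient
    -- of a² that each entry contributes.
    sumSq-shifts : ∀ a j xs →
      6 * sumSq (shifts a j xs) ≡ suc j * (6 * sumSq xs + 6 * (j * a * sum xs) + j * suc (2 * j) * (a * a) * length xs)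
    sumSq-shifts a zero xs = eq a (sum xs) (sumSq xs) (length xs)
      where
      eq : ∀ a s q n → 6 * q ≡ 1 * (6 * q + 6 * (0 * a * s) + 0 * 1 * (a * a) * n)
      eq = ℕ-Solver.solve-∀
    sumSq-shifts a (suc j) xs = begin
      6 * sum (map (λ x → x * x) (xs ++ map (a ℕ.+_) ys))
        ≡⟨ cong (λ u → 6 * sum u) (List.map-++ (λ x → x * x) xs (map (a ℕ.+_) ys)) ⟩
      6 * sum (map (λ x → x * x) xs ++ map (λ x → x * x) (map (a ℕ.+_) ys))
        ≡⟨ cong (6 *_) (sum-++ (map (λ x → x * x) xs) (map (λ x → x * x) (map (a ℕ.+_) ys))) ⟩
      6 * (q + sumSq (map (a ℕ.+_) ys))
        ≡⟨ cong (λ u → 6 * (q + u)) (sumSq-translate a ys) ⟩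
      6 * (q + (sumSq ys + 2 * (a * sum ys) + length ys * (a * a)))
        ≡⟨ cong (λ u → 6 * (q + (sumSq ys + 2 * (a * sum ys) + u * (a * a)))) (length-shifts a j xs) ⟩
      6 * (q + (sumSq ys + 2 * (a * sum ys) + suc j * n * (a * a)))
        ≡⟨ eq a j q n (sumSq ys) (sum ys) ⟩
      6 * q + 6 * sumSq ys + 6 * a * (2 * sum ys) + 6 * (suc j * n * (a * a))
        ≡⟨ cong₂ (λ u v → 6 * q + u + 6 * a * v + 6 * (suc j * n * (a * a))) (sumSq-shifts a j xs) (sum-shifts a j xs) ⟩
      6 * q + suc j * (6 * q + 6 * (j * a * s) + j * suc (2 * j) * (a * a) * n) + 6 * a * (suc j * (2 * s + a * j * n)) + 6 * (suc j * n * (a * a))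
        ≡⟨ eq′ a j s q n ⟩
      suc (suc j) * (6 * q + 6 * (suc j * a * s) + suc j * suc (2 * suc j) * (a * a) * n) ∎
      where
      ys = shifts a j xs
      s = sum xs
      q = sumSq xs
      n = length xs
      eq : ∀ a j q n q′ s′ → 6 * (q + (q′ + 2 * (a * s′) + suc j * n * (a * a))) ≡ 6 * q + 6 * q′ + 6 * a * (2 * s′) + 6 * (suc j * n * (a * a))
      eq = ℕ-Solver.solve-∀
      eq′ : ∀ a j s q n → 6 * q + suc j * (6 * q + 6 * (j * a * s) + j * suc (2 * j) * (a * a) * n) + 6 * a * (suc j * (2 * s + a * j * n)) + 6 * (suc j * n * (a * a)) ≡
        suc (suc j) * (6 * q + 6 * (suc j * a * s) + suc j * suc (2 * suc j) * (a * a) * n)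
      eq′ = ℕ-Solver.solve-∀

    length-subsums : ∀ k as → length (subsums k as) ≡ suc k ^ length as
    length-subsums k [] = refl
    length-subsums k (a ∷ as) = trans (length-shifts a k (subsums k as)) (cong (suc k *_) (length-subsums k as))

    -- A uniform digit in {0,…,k} has variance k (k + 2) / 12.
    variance-subsums : ∀ k as → let xs = subsums k as; n = length xs in
      12 * (n * sumSq xs) ≡ 12 * (sum xs * sum xs) + n * n * (k * (k + 2) * sumSq as)
    variance-subsums k [] = eq k
      where
      eq : ∀ k → 0 ≡ 1 * (k * (k + 2) * 0)
      eq = ℕ-Solver.solve-∀
    variance-subsums k (a ∷ as) = begin
      12 * (length ys * sumSq ys)
        ≡⟨ eq₁ (length ys) (sumSq ys) ⟩
      2 * (length ys * (6 * sumSq ys))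
        ≡⟨ cong₂ (λ u v → 2 * (u * v)) (length-shifts a k xs) (sumSq-shifts a k xs) ⟩
      2 * (suc k * n * (suc k * (6 * q + 6 * (k * a * s) + k * suc (2 * k) * (a * a) * n)))
        ≡⟨ eq₂ a k n s q ⟩
      suc k * suc k * (12 * (n * q)) + suc k * suc k * (12 * (k * a * n * s) + 2 * (k * suc (2 * k) * (a * a) * (n * n)))
        ≡⟨ cong (λ u → suc k * suc k * u + suc k * suc k * (12 * (k * a * n * s) + 2 * (k * suc (2 * k) * (a * a) * (n * n)))) (variance-subsums k as) ⟩
      suc k * suc k * (12 * (s * s) + n * n * (k * (k + 2) * v)) + suc k * suc k * (12 * (k * a * n * s) + 2 * (k * suc (2 * k) * (a * a) * (n * n)))
        -- `sum-shifts` controls only twice the sum, so twelve times the squared sum appears as 3 (2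
        -- sum)². The coefficients of a² combine as 2k (2k + 1) - 3k² = k (k + 2).
        ≡⟨ eq₃ a k n s v ⟩
      3 * ((suc k * (2 * s + a * k * n)) * (suc k * (2 * s + a * k * n))) + suc k * n * (suc k * n) * (k * (k + 2) * (a * a + v))
        ≡⟨ cong₂ (λ u w → 3 * (u * u) + w * w * (k * (k + 2) * (a * a + v))) (sum-shifts a k xs) (length-shifts a k xs) ⟨
      3 * ((2 * sum ys) * (2 * sum ys)) + length ys * length ys * (k * (k + 2) * (a * a + v))
        ≡⟨ eq₄ (sum ys) (length ys * length ys * (k * (k + 2) * (a * a + v))) ⟩
      12 * (sum ys * sum ys) + length ys * length ys * (k * (k + 2) * (a * a + v)) ∎
      where
      xs = subsums k as
      ys = shifts a k xs
      s = sum xs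
      q = sumSq xs
      n = length xs
      v = sumSq as
      eq₁ : ∀ n q → 12 * (n * q) ≡ 2 * (n * (6 * q))
      eq₁ = ℕ-Solver.solve-∀
      eq₂ : ∀ a k n s q → 2 * (suc k * n * (suc k * (6 * q + 6 * (k * a * s) + k * suc (2 * k) * (a * a) * n))) ≡
        suc k * suc k * (12 * (n * q)) + suc k * suc k * (12 * (k * a * n * s) + 2 * (k * suc (2 * k) * (a * a) * (n * n)))
      eq₂ = ℕ-Solver.solve-∀
      eq₃ : ∀ a k n s v → suc k * suc k * (12 * (s * s) + n * n * (k * (k + 2) * v)) + suc k * suc k * (12 * (k * a * n * s) + 2 * (k * suc (2 * k) * (a * a) * (n * n))) ≡
        3 * ((suc k * (2 * s + a * k * n)) * (suc k * (2 * s + a * k * n))) + suc k * n * (suc k * n) * (k * (k + 2) * (a * a + v))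
      eq₃ = ℕ-Solver.solve-∀
      eq₄ : ∀ s r → 3 * ((2 * s) * (2 * s)) + r ≡ 12 * (s * s) + r
      eq₄ = ℕ-Solver.solve-∀

  open Moments using (length-subsums; variance-subsums)

  -- Distinctness of the digit sums, and the resulting bound.

  ∈-shifts⁻ : ∀ a j xs {y} → y ∈ shifts a j xs → ∃[ c ] c ≤ j × ∃[ x ] x ∈ xs × y ≡ c ℕ.* a ℕ.+ x
  ∈-shifts⁻ a zero xs {y} y∈ = 0 , z≤n , y , y∈ , refl
  ∈-shifts⁻ a (suc j) xs {y} y∈ with ∈-++⁻ xs y∈
  ... | inj₁ y∈xs = 0 , z≤n , y , y∈xs , refl
  ... | inj₂ y∈map with ∈-map⁻ (a ℕ.+_) y∈map
  ...   | z , z∈ , refl with ∈-shifts⁻ a j xs z∈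
  ...     | c , c≤j , x , x∈ , refl = suc c , s≤s c≤j , x , x∈ , sym (ℕ.+-assoc a (c ℕ.* a) x)

  -- Equal entries in two different translates cancel down to two entries of `xs` that differ by a
  -- positive multiple of `a`, at most `j` times `a`; the second hypothesis excludes this.
  shifts-unique : ∀ a j {xs} → Unique xs → (∀ {c x y} → c < j → x ∈ xs → y ∈ xs → x ≢ suc c ℕ.* a ℕ.+ y) →
                  Unique (shifts a j xs)
  shifts-unique a zero xs! h = xs!
  shifts-unique a (suc j) {xs} xs! h = Unique.++⁺ xs!
    (Unique.map⁺ (ℕ.+-cancelˡ-≡ a _ _) (shifts-unique a j xs! (λ c<j → h (ℕ.m<n⇒m<1+n c<j))))
    disjoint
    where
    disjoint : ∀ {x} → x ∈ xs × x ∈ map (a ℕ.+_) (shifts a j xs) → _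
    disjoint (x∈ , x∈map) with ∈-map⁻ (a ℕ.+_) x∈map
    ... | z , z∈ , refl with ∈-shifts⁻ a j xs z∈
    ...   | c , c≤j , y , y∈ , refl = h (s≤s c≤j) x∈ y∈ (sym (ℕ.+-assoc a (c ℕ.* a) y))

  combination : (ℕ → ℤ) → List ℕ → ℤ
  combination ε xs = ∑ℤ (map (λ s → ε s ℤ.* + s) xs)

  -- Coefficients in `Is𝒟` depend on the element and not on its position, so a combination is
  -- extended by overriding `ε` at the new head. The tail keeps its coefficients because the head
  -- does not occur in it.
  update : ℕ → ℤ → (ℕ → ℤ) → ℕ → ℤ
  update a i ε s with s ℕ.≟ a
  ... | yes _ = i
  ... | no _ = ε s

  update-≡ : ∀ a i ε → update a i ε a ≡ i
  update-≡ a i ε with a ℕ.≟ a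
  ... | yes _ = refl
  ... | no a≢a = contradiction refl a≢a

  update-≢ : ∀ {a s} i ε → a ≢ s → update a i ε s ≡ ε s
  update-≢ {a} {s} i ε a≢s with s ℕ.≟ a
  ... | yes refl = contradiction refl a≢s
  ... | no _ = refl

  combination-update : ∀ {a} i ε {xs} → All (a ≢_) xs → combination (update a i ε) xs ≡ combination ε xs
  combination-update i ε [] = refl
  combination-update i ε {x ∷ xs} (a≢x ∷ a≢xs) =
    cong₂ ℤ._+_ (cong (ℤ._* + x) (update-≢ i ε a≢x)) (combination-update i ε a≢xs)

  Bounded : ℕ → (ℕ → ℤ) → Pred ℕ 0ℓ
  Bounded k ε s = ℤ.∣ ε s ∣ ≤ k

  extend-bounded : ∀ {k a i ε xs} → All (a ≢_) xs → ℤ.∣ i ∣ ≤ k → All (Bounded k ε) xs →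
                   All (Bounded k (update a i ε)) (a ∷ xs)
  extend-bounded {k} {a} {i} {ε} a≢xs ∣i∣≤k bs =
    subst (λ u → ℤ.∣ u ∣ ≤ k) (sym (update-≡ a i ε)) ∣i∣≤k ∷
    All.zipWith (λ (a≢s , b) → subst (λ u → ℤ.∣ u ∣ ≤ k) (sym (update-≢ i ε a≢s)) b) (a≢xs , bs)

  ∣m-n∣≤ : ∀ {m n k} → m ≤ k → n ≤ k → ℤ.∣ + m ℤ.- + n ∣ ≤ k
  ∣m-n∣≤ {m} {n} m≤k n≤k = ℕ.≤-trans (ℕ.≤-reflexive (cong ℤ.∣_∣ (ℤ.m-n≡m⊖n m n)))
    (ℕ.≤-trans (ℤ.∣m⊝n∣≤m⊔n m n) (ℕ.⊔-lub m≤k n≤k))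

  pos-affine : ∀ c a x → + (c ℕ.* a ℕ.+ x) ≡ + c ℤ.* + a ℤ.+ + x
  pos-affine c a x = trans (ℤ.pos-+ (c ℕ.* a) x) (cong (ℤ._+ + x) (ℤ.pos-* c a))

  -- Differences of two digits between 0 and k range from -k to k, exactly the coefficients that
  -- `Is𝒟` admits.
  subsums-difference : ∀ k as → Unique as → ∀ {x y} → x ∈ subsums k as → y ∈ subsums k as →
                       ∃[ ε ] All (Bounded k ε) as × + x ℤ.- + y ≡ combination ε as
  subsums-difference k [] [] (here refl) (here refl) = (λ _ → 0ℤ) , [] , refl
  subsums-difference k (a ∷ as) (a≢as ∷ as!) x∈ y∈
    with ∈-shifts⁻ a k (subsums k as) x∈ | ∈-shifts⁻ a k (subsums k as) y∈
  ... | c , c≤k , x , x∈ , refl | d , d≤k , y , y∈ , refl with subsums-difference k as as! x∈ y∈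
  ...   | ε , bs , e = update a i ε , extend-bounded a≢as (∣m-n∣≤ c≤k d≤k) bs , (begin
    + (c ℕ.* a ℕ.+ x) ℤ.- + (d ℕ.* a ℕ.+ y)                          ≡⟨ cong₂ ℤ._-_ (pos-affine c a x) (pos-affine d a y) ⟩
    (+ c ℤ.* + a ℤ.+ + x) ℤ.- (+ d ℤ.* + a ℤ.+ + y)                  ≡⟨ eq (+ c) (+ d) (+ a) (+ x) (+ y) ⟩
    i ℤ.* + a ℤ.+ (+ x ℤ.- + y)                                      ≡⟨ cong (λ u → i ℤ.* + a ℤ.+ u) e ⟩
    i ℤ.* + a ℤ.+ combination ε as
      ≡⟨ cong₂ (λ u v → u ℤ.* + a ℤ.+ v) (update-≡ a i ε) (combination-update i ε a≢as) ⟨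
    combination (update a i ε) (a ∷ as)                              ∎)
    where
    open ≡-Reasoning
    i = + c ℤ.- + d
    eq : ∀ c d a x y → (c ℤ.* a ℤ.+ x) ℤ.- (d ℤ.* a ℤ.+ y) ≡ (c ℤ.- d) ℤ.* a ℤ.+ (x ℤ.- y)
    eq = ℤ-Solver.solve-∀

  subsums-unique : ∀ {k S} → Is𝒟 k S → ∀ as → Unique as → All S as → Unique (subsums k as)
  subsums-unique 𝒟 [] _ _ = [] ∷ []
  subsums-unique {k} {S} 𝒟 (a ∷ as) (a≢as ∷ as!) (Sa ∷ Sas) =
    shifts-unique a k (subsums-unique 𝒟 as as! Sas) noCollision
    where
    noCollision : ∀ {c x y} → c < k → x ∈ subsums k as → y ∈ subsums k as → x ≢ suc c ℕ.* a ℕ.+ y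
    -- With y - x represented rather than x - y, the relation (c + 1) a + (y - x) = 0 has the head
    -- coefficient c + 1, which is nonzero and at most k.
    noCollision {c} {x} {y} c<k x∈ y∈ x≡ with subsums-difference k as as! y∈ x∈
    ... | ε , bs , e with 𝒟 (a ∷ as) (update a (+ suc c) ε) (a≢as ∷ as!) (Sa ∷ Sas) (extend-bounded a≢as c<k bs) vanishing
      where
      open ≡-Reasoning
      eq : ∀ b y → b ℤ.+ (y ℤ.- (b ℤ.+ y)) ≡ 0ℤ
      eq = ℤ-Solver.solve-∀
      vanishing : combination (update a (+ suc c) ε) (a ∷ as) ≡ 0ℤ
      vanishing = begin
        combination (update a (+ suc c) ε) (a ∷ as)
          ≡⟨ cong₂ (λ u v → u ℤ.* + a ℤ.+ v) (update-≡ a (+ suc c) ε) (combination-update (+ suc c) ε a≢as) ⟩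
        + suc c ℤ.* + a ℤ.+ combination ε as
          ≡⟨ cong (λ u → + suc c ℤ.* + a ℤ.+ u) e ⟨
        + suc c ℤ.* + a ℤ.+ (+ y ℤ.- + x)
          ≡⟨ cong (λ u → + suc c ℤ.* + a ℤ.+ (+ y ℤ.- u)) (trans (cong +_ x≡) (pos-affine (suc c) a y)) ⟩
        + suc c ℤ.* + a ℤ.+ (+ y ℤ.- (+ suc c ℤ.* + a ℤ.+ + y))
          ≡⟨ eq (+ suc c ℤ.* + a) (+ y) ⟩
        0ℤ ∎
    ...   | εa≡0 ∷ _ with trans (sym (update-≡ a (+ suc c) ε)) εa≡0
    ...     | ()

  -- For the n digit sums, `unique-spread` bounds the variance below and `variance-subsums`
  -- evaluates it. The common term 12 s² and the factor n² > 0 cancel, leaving n² ≤ v + 1.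
  𝒟-sumSq : ∀ {k S} → Is𝒟 k S → ∀ as → Unique as → All S as →
            (suc k ^ length as) ℕ.* (suc k ^ length as) ≤ k ℕ.* (k ℕ.+ 2) ℕ.* sumSq as ℕ.+ 1
  𝒟-sumSq {k} 𝒟 as as! Sas = subst (λ n → n ℕ.* n ≤ v ℕ.+ 1) (length-subsums k as)
    (ℕ.*-cancelˡ-≤ (n ℕ.* n) {{nn≢0}} (ℕ.+-cancelˡ-≤ (12 ℕ.* (s ℕ.* s)) _ _ (begin
      12 ℕ.* (s ℕ.* s) ℕ.+ n ℕ.* n ℕ.* (n ℕ.* n)              ≤⟨ unique-spread xs (subsums-unique 𝒟 as as! Sas) ⟩
      12 ℕ.* (n ℕ.* sumSq xs) ℕ.+ n ℕ.* n                     ≡⟨ cong (ℕ._+ n ℕ.* n) (variance-subsums k as) ⟩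
      12 ℕ.* (s ℕ.* s) ℕ.+ n ℕ.* n ℕ.* v ℕ.+ n ℕ.* n          ≡⟨ eq (12 ℕ.* (s ℕ.* s)) (n ℕ.* n) v ⟩
      12 ℕ.* (s ℕ.* s) ℕ.+ n ℕ.* n ℕ.* (v ℕ.+ 1)              ∎)))
    where
    open ℕ.≤-Reasoning
    xs = subsums k as
    s = sum xs
    n = length xs
    v = k ℕ.* (k ℕ.+ 2) ℕ.* sumSq as
    nn≢0 : NonZero (n ℕ.* n)
    nn≢0 = subst (λ n → NonZero (n ℕ.* n)) (sym (length-subsums k as))
      (ℕ.m*n≢0 _ _ {{ℕ.m^n≢0 (suc k) (length as)}} {{ℕ.m^n≢0 (suc k) (length as)}})
    eq : ∀ a b v → a ℕ.+ b ℕ.* v ℕ.+ b ≡ a ℕ.+ b ℕ.* (v ℕ.+ 1)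
    eq = ℕ-Solver.solve-∀

  sumSq≤ : ∀ {n as} → All (_≤ n) as → sumSq as ≤ length as ℕ.* (n ℕ.* n)
  sumSq≤ [] = z≤n
  sumSq≤ (a≤n ∷ as≤n) = ℕ.+-mono-≤ (ℕ.*-mono-≤ a≤n a≤n) (sumSq≤ as≤n)

  𝒟-bound : ∀ {k S} → Is𝒟 k S → ∀ {n} as → Unique as → All S as → All (_≤ n) as →
            (suc k ^ length as) ℕ.* (suc k ^ length as) ≤ k ℕ.* (k ℕ.+ 2) ℕ.* (length as ℕ.* (n ℕ.* n)) ℕ.+ 1
  𝒟-bound {k} 𝒟 as as! Sas as≤n = ℕ.≤-trans (𝒟-sumSq 𝒟 as as! Sas)
    (ℕ.+-monoˡ-≤ 1 (ℕ.*-monoʳ-≤ (k ℕ.* (k ℕ.+ 2)) (sumSq≤ as≤n)))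

-- Integer inequalities comparing the count with log₂ n.

module Arithmetic where

  open import Data.Nat.Base
  open import Data.Nat.Properties
  open import Data.Nat.Tactic.RingSolver using (solve-∀)
  open import Data.Product.Base using (_×_; _,_; ∃-syntax)
  open import Data.Sum.Base using (_⊎_; inj₁; inj₂)
  open import Relation.Binary.PropositionalEquality hiding ([_])
  open import Relation.Nullary using (¬_; yes; no; contradiction)
  open ≤-Reasoning

  log₂-floor : ∀ n → 1 ≤ n → ∃[ l ] 2 ^ l ≤ n × n < 2 ^ suc l
  log₂-floor 1 _ = 0 , ≤-refl , ≤-refl
  log₂-floor (suc n@(suc _)) _ with log₂-floor n (s≤s z≤n)
  ... | l , lo , hi with suc n <? 2 ^ suc l
  ...   | yes 1+n< = l , m≤n⇒m≤1+n lo , 1+n<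
  ...   | no 1+n≮ = suc l , ≮⇒≥ 1+n≮ , ≤-<-trans hi (^-monoʳ-< 2 ≤-refl {suc l} {suc (suc l)} ≤-refl)

  suc-cube≤4*cube : ∀ {m} → 2 ≤ m → suc m * suc m * suc m ≤ 4 * (m * m * m)
  suc-cube≤4*cube 2≤m with m≤n⇒∃[o]m+o≡n 2≤m
  ... | d , refl = ≤-trans (m≤m+n _ (3 * (d * d * d) + 15 * (d * d) + 21 * d + 5)) (≤-reflexive (eq d))
    where
    eq : ∀ d → (3 + d) * (3 + d) * (3 + d) + (3 * (d * d * d) + 15 * (d * d) + 21 * d + 5) ≡ 4 * ((2 + d) * (2 + d) * (2 + d))
    eq = solve-∀

  cube<4^-step : ∀ {m j} → 2 ≤ m → m * m * m < 4 ^ j → ∀ d → (d + m) * (d + m) * (d + m) < 4 ^ (d + j)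
  cube<4^-step 2≤m h zero = h
  cube<4^-step {m} {j} 2≤m h (suc d) =
    ≤-<-trans (suc-cube≤4*cube {d + m} (≤-trans 2≤m (m≤n+m m d))) (*-monoʳ-< 4 (cube<4^-step {m} {j} 2≤m h d))

  13³<4⁶ : 13 * 13 * 13 < 4 ^ 6
  13³<4⁶ = <ᵇ⇒< 2197 4096 _

  -- 13 is the least m ≥ 7 with m³ < 4^(m - 7), and each later step multiplies the cube by at most
  -- 4. This is the origin of the threshold 12 for small counts.
  suc-cube<4^ : ∀ {c} → 12 < suc c → ∃[ j ] j + 6 ≡ c × suc c * suc c * suc c < 4 ^ j
  suc-cube<4^ {c} 12<1+c = d + 6 , d+6+6≡c ,
    subst (λ m → m * m * m < 4 ^ (d + 6)) d+13≡1+c (cube<4^-step {13} {6} (s≤s (s≤s z≤n)) 13³<4⁶ d)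
    where
    d = suc c ∸ 13
    d+13≡1+c : d + 13 ≡ suc c
    d+13≡1+c = m∸n+n≡m 12<1+c
    d+6+6≡c : d + 6 + 6 ≡ c
    d+6+6≡c = trans (+-assoc d 6 6) (m∸n+n≡m (s≤s⁻¹ 12<1+c))

  2^*2^≡4^ : ∀ l → 2 ^ l * 2 ^ l ≡ 4 ^ l
  2^*2^≡4^ zero = refl
  2^*2^≡4^ (suc l) = trans (eq (2 ^ l)) (cong (4 *_) (2^*2^≡4^ l))
    where
    eq : ∀ p → 2 * p * (2 * p) ≡ 4 * (p * p)
    eq = solve-∀

  cube-^ : ∀ b n → b ^ n * b ^ n * b ^ n ≡ b ^ (n + n + n)
  cube-^ b n = sym (trans (^-distribˡ-+-* b (n + n) n) (cong (_* b ^ n) (^-distribˡ-+-* b n n)))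

  4^-cube : ∀ {i j n} → i + j ≡ n + n + n → 4 ^ i * 4 ^ j ≡ 4 ^ n * 4 ^ n * 4 ^ n
  4^-cube {i} {j} {n} e = trans (sym (^-distribˡ-+-* 4 i j)) (trans (cong (4 ^_) e) (sym (cube-^ 4 n)))

  -- Cube p ≤ m f, then cancel x. In the application p, f, x, y are the powers of 4 with exponents
  -- c, l + 1, 2c + 6 and c - 6.
  cubes-collide : ∀ {m f p x y} .{{_ : NonZero x}} → x * y ≡ p * p * p → p ≤ m * f → f * f * f ≤ x → y ≤ m * m * m
  cubes-collide {m} {f} {p} {x} {y} xy≡ppp p≤mf fff≤x = *-cancelˡ-≤ x (begin
    x * y                      ≡⟨ xy≡ppp ⟩
    p * p * p                  ≤⟨ *-mono-≤ (*-mono-≤ p≤mf p≤mf) p≤mf ⟩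
    m * f * (m * f) * (m * f)  ≡⟨ eq m f ⟩
    f * f * f * (m * m * m)    ≤⟨ *-monoˡ-≤ (m * m * m) fff≤x ⟩
    x * (m * m * m)            ∎)
    where
    eq : ∀ m f → m * f * (m * f) * (m * f) ≡ f * f * f * (m * m * m)
    eq = solve-∀

  square≤4^ : ∀ {n} l → n ≤ 2 ^ l → n * n ≤ 4 ^ l
  square≤4^ l n≤2^l = ≤-trans (*-mono-≤ n≤2^l n≤2^l) (≤-reflexive (2^*2^≡4^ l))

  cube≤4^ : ∀ l n → l + l + l ≤ n → 4 ^ l * 4 ^ l * 4 ^ l ≤ 4 ^ n
  cube≤4^ l n h = ≤-trans (≤-reflexive (cube-^ 4 l)) (^-monoʳ-≤ 4 {l + l + l} {n} h)

  -- If both held, then 3 (l + 1) ≤ 2c + 6, and cubing would give 4^(3c) ≤ (c + 1)³ 4^(2c + 6), that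
  -- is 4^(c - 6) ≤ (c + 1)³, which fails for c ≥ 12. Cubes keep the ratio 3/2 within integer
  -- exponents.
  ¬many-and-short : ∀ {c n l} → n < 2 ^ suc l → 4 ^ c ≤ suc c * (n * n) → 12 < suc c → ¬ 3 * l < 2 * (suc c + 1)
  ¬many-and-short {c} {n} {l} n<2^ 4^c≤ 12<1+c 3l< =
    let j , j+6≡c , ccc<4^j = suc-cube<4^ {c} 12<1+c
    in <⇒≱ ccc<4^j (cubes-collide {suc c} {4 ^ suc l} {4 ^ c} {4 ^ (c + c + 6)} {4 ^ j} {{m^n≢0 4 (c + c + 6)}}
      (4^-cube {c + c + 6} {j} {c} (trans (eq₁ c j) (cong (c + c +_) j+6≡c)))
      (≤-trans 4^c≤ (*-monoʳ-≤ (suc c) (square≤4^ (suc l) (<⇒≤ n<2^))))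
      (cube≤4^ (suc l) (c + c + 6) (begin
        suc l + suc l + suc l    ≡⟨ eq₂ l ⟩
        suc (3 * l) + 2          ≤⟨ +-monoˡ-≤ 2 3l< ⟩
        2 * (suc c + 1) + 2      ≡⟨ eq₃ c ⟩
        c + c + 6                ∎)))
    where
    eq₁ : ∀ c j → c + c + 6 + j ≡ c + c + (j + 6)
    eq₁ = solve-∀
    eq₂ : ∀ l → suc l + suc l + suc l ≡ suc (3 * l) + 2
    eq₂ = solve-∀
    eq₃ : ∀ c → 2 * (suc c + 1) + 2 ≡ c + c + 6
    eq₃ = solve-∀

  few-or-long : ∀ {c n l} → n < 2 ^ suc l → 4 ^ c ≤ suc c * (n * n) → suc c ≤ 12 ⊎ 2 * (suc c + 1) ≤ 3 * l
  few-or-long {c} {n} {l} n<2^ 4^c≤ with suc c ≤? 12 | 2 * (suc c + 1) ≤? 3 * l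
  ... | yes p | _ = inj₁ p
  ... | no _ | yes q = inj₂ q
  ... | no p | no q = contradiction (≰⇒> q) (¬many-and-short {c} {n} {l} n<2^ 4^c≤ (≰⇒> p))

  -- As k (k + 2) + 1 = (k + 1)², the +1 merges with w ≥ 1 and one factor (k + 1)² cancels. The base
  -- k + 1 ≥ 2 then leaves a bound free of k.
  4^≤count : ∀ {k c n} → 1 ≤ k → 1 ≤ n →
    (suc k ^ suc c) * (suc k ^ suc c) ≤ k * (k + 2) * (suc c * (n * n)) + 1 → 4 ^ c ≤ suc c * (n * n)
  4^≤count {k} {c} {n} 1≤k 1≤n h = begin
    4 ^ c                      ≡⟨ 2^*2^≡4^ c ⟨
    2 ^ c * 2 ^ c              ≤⟨ *-mono-≤ (^-monoˡ-≤ c (s≤s 1≤k)) (^-monoˡ-≤ c (s≤s 1≤k)) ⟩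
    suc k ^ c * suc k ^ c      ≤⟨ *-cancelˡ-≤ (suc k * suc k) (begin
      (suc k * suc k) * (suc k ^ c * suc k ^ c)    ≡⟨ eq₁ (suc k) (suc k ^ c) ⟩
      suc k ^ suc c * suc k ^ suc c                ≤⟨ h ⟩
      k * (k + 2) * w + 1                          ≤⟨ +-monoʳ-≤ (k * (k + 2) * w) 1≤w ⟩
      k * (k + 2) * w + w                          ≡⟨ eq₂ k w ⟩
      (suc k * suc k) * w                          ∎) ⟩
    w                          ∎
    where
    w = suc c * (n * n)
    1≤w : 1 ≤ w
    1≤w = *-mono-≤ {1} {suc c} {1} {n * n} (s≤s z≤n) (*-mono-≤ 1≤n 1≤n)
    eq₁ : ∀ s p → (s * s) * (p * p) ≡ s * p * (s * p)
    eq₁ = solve-∀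
    eq₂ : ∀ k w → k * (k + 2) * w + w ≡ (suc k * suc k) * w
    eq₂ = solve-∀

  -- The +1 is paid for by one more copy of k (k + 2) n², which turns c into c + 1. For b = (k +
  -- 1)^(2c) the result reads (k + 1)^(2c) ≤ n² · l · (3/2) k (k + 2), ready for logarithms.
  absorb-count : ∀ {k c n l b} → 1 ≤ k → 1 ≤ n → b ≤ k * (k + 2) * (c * (n * n)) + 1 →
    2 * (c + 1) ≤ 3 * l → 2 * b ≤ 3 * l * (k * (k + 2) * (n * n))
  absorb-count {k} {c} {n} {l} {b} 1≤k 1≤n h c≤ = begin
    2 * b                                          ≤⟨ *-monoʳ-≤ 2 h ⟩
    2 * (k * (k + 2) * (c * (n * n)) + 1)          ≤⟨ *-monoʳ-≤ 2 (+-monoʳ-≤ (k * (k + 2) * (c * (n * n))) 1≤w) ⟩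
    2 * (k * (k + 2) * (c * (n * n)) + w)          ≡⟨ eq (k * (k + 2)) c (n * n) ⟩
    2 * (c + 1) * w                                ≤⟨ *-monoˡ-≤ w c≤ ⟩
    3 * l * w                                      ∎
    where
    w = k * (k + 2) * (n * n)
    1≤w : 1 ≤ w
    1≤w = *-mono-≤ (*-mono-≤ 1≤k (≤-trans (s≤s z≤n) (m≤n+m 2 k))) (*-mono-≤ 1≤n 1≤n)
    eq : ∀ K c N → 2 * (K * (c * N) + K * N) ≡ 2 * (c + 1) * (K * N)
    eq = solve-∀

  -- 512 = 2⁹, where 2 (12 + 1) ≤ 3 · 9.
  few-or-absorbed : ∀ {k c n l} → 1 ≤ k → 1 ≤ n → n < 2 ^ suc l →
    (suc k ^ c) * (suc k ^ c) ≤ k * (k + 2) * (c * (n * n)) + 1 →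
    (c ≤ 12 × n < 512) ⊎ 2 * ((suc k ^ c) * (suc k ^ c)) ≤ 3 * l * (k * (k + 2) * (n * n))
  few-or-absorbed {k} {c} {n} {l} 1≤k 1≤n n<2^ h with few c h
    where
    few : ∀ c → (suc k ^ c) * (suc k ^ c) ≤ k * (k + 2) * (c * (n * n)) + 1 → c ≤ 12 ⊎ 2 * (c + 1) ≤ 3 * l
    few zero _ = inj₁ z≤n
    few (suc c) h = few-or-long {c} {n} {l} n<2^ (4^≤count {k} {c} {n} 1≤k 1≤n h)
  ... | inj₂ c≤ = inj₂ (absorb-count {k} {c} {n} {l} 1≤k 1≤n h c≤)
  ... | inj₁ c≤12 with n <? 512
  ...   | yes n<512 = inj₁ (c≤12 , n<512)
  ...   | no n≮512 = inj₂ (absorb-count {k} {c} {n} {l} 1≤k 1≤n h (begin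
    2 * (c + 1)    ≤⟨ *-monoʳ-≤ 2 (+-monoˡ-≤ 1 c≤12) ⟩
    26             ≤⟨ n≤1+n 26 ⟩
    3 * 9          ≤⟨ *-monoʳ-≤ 3 9≤l ⟩
    3 * l          ∎))
    where
    9≤l : 9 ≤ l
    9≤l = ≮⇒≥ λ l<9 → <⇒≱ n<2^ (≤-trans (^-monoʳ-≤ 2 l<9) (≮⇒≥ n≮512))

  -- Since b² ≥ 4, the +1 is at most b² / 4, so b² - 1 ≥ (3/4) b².
  3*square≤4* : ∀ {b x} → 2 ≤ b → b * b ≤ x + 1 → 3 * (b * b) ≤ 4 * x
  3*square≤4* {b} {x} 2≤b h = +-cancelʳ-≤ 4 _ _ (begin
    3 * (b * b) + 4        ≤⟨ +-monoʳ-≤ (3 * (b * b)) (*-mono-≤ 2≤b 2≤b) ⟩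
    3 * (b * b) + b * b    ≡⟨ +-comm (3 * (b * b)) (b * b) ⟩
    4 * (b * b)            ≤⟨ *-monoʳ-≤ 4 h ⟩
    4 * (x + 1)            ≡⟨ *-distribˡ-+ 4 x 1 ⟩
    4 * x + 4              ∎)

-- Rational approximations of π, square roots and logarithms.

module Approximation where

  import Algebra.Properties.CommutativeSemiring.Exp as Exponent
  open import Algebra.Bundles using (CommutativeRing)
  open import Data.Integer.Base using (+_)
  open import Data.Nat.Base as ℕ using (ℕ; zero; suc)
  import Data.Nat.Properties as ℕ
  import Data.Nat.Tactic.RingSolver as ℕ-Solver
  open import Data.Product.Base using (_,_; ∃-syntax)
  open import Data.Rational.Base as ℚ using (ℚ; 0ℚ; 1ℚ; ½)
  import Data.Rational.Properties as ℚ
  open import Data.Sum.Base using (_⊎_; inj₁; inj₂)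
  open import Defs using (module Rational; module Sequence; greatest-max)
  open import Relation.Binary.PropositionalEquality
  open import Relation.Nullary using (yes; no; contradiction)
  open import Tactic.RingSolver using (solve-∀)
  open Rational
  open Sequence using (logApprox; logNumerator; piApprox; sqrtApprox; module Cauchy; module Log; module Log₂; module Pi; module Sqrt)
  open Cauchy using (recip; recip-pos; recip-inverse)
  private module Exp = Exponent (CommutativeRing.commutativeSemiring ℚ.+-*-commutativeRing)
  open Exp using () renaming (_^_ to _^ℚ_)

  -- So 2π/3 ≥ 3/2, matching the hypothesis 2 (c + 1) ≤ 3 l of absorb-count.
  π≥9/4 : ∃[ N ] ∀ i → N ℕ.≤ i → ι 9 ≤ ι 4 * piApprox i
  -- The quarter disc of radius 5 contains 15 points, so `piApprox 4` is 12/5, and 12/5 - 3/20 =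
  -- 9/4. `Pi.compare` lets this one coarse count bound all sufficiently fine ones.
  π≥9/4 = let d , p = Pi.eighth {+ 3 / 20} (ℚ.positive⁻¹ (+ 3 / 20)) in d , λ i d≤i →
    ≤-respˡ value (≤-*ˡ {piApprox 4 - (+ 3 / 20)} {piApprox i} {ι 4} (0≤ι 4)
      (≤+⇒-≤ {piApprox 4} {+ 3 / 20} {piApprox i}
        (ℚ.≤-trans (Pi.compare 4 i (p i d≤i)) (ℚ.≤-reflexive (ℚ.+-comm (piApprox i) (+ 3 / 20))))))
    where
    value : ι 4 * (piApprox 4 - (+ 3 / 20)) ≡ ι 9
    value = refl

  square-cancel-≤ : ∀ {x y} → 0ℚ ≤ y → x * x ≤ y * y → x ≤ y
  square-cancel-≤ {x} {y} 0≤y xx≤yy with x ℚ.≤? y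
  ... | yes x≤y = x≤y
  ... | no x≰y = contradiction (ℚ.<-≤-trans (ℚ.≤-<-trans (≤-*ˡ 0≤y (ℚ.<⇒≤ y<x)) yx<xx) xx≤yy) (ℚ.<-irrefl refl)
    where
    y<x : y < x
    y<x = ℚ.≰⇒> x≰y
    yx<xx : y * x < x * x
    yx<xx = ℚ.*-monoˡ-<-pos x {{ℚ.positive (ℚ.≤-<-trans 0≤y y<x)}} y<x

  -- `sqrtApprox` rounds down, so the upper bound holds at every index without an error term. Its
  -- fallback value 0 is covered by 0 ≤ α.
  scaled-sqrt≤ : ∀ {β q α} i → 0ℚ ≤ β → 0ℚ ≤ α → β * β * q ≤ α * α → β * sqrtApprox q i ≤ α
  scaled-sqrt≤ {β} {q} {α} i 0≤β 0≤α h = go (sqrtApprox q i) (Sqrt.lower q i)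
    where
    eq : ∀ β s → β * s * (β * s) ≡ β * β * (s * s)
    eq = solve-∀ ring
    go : ∀ s → s * s ≤ q ⊎ s ≡ 0ℚ → β * s ≤ α
    go s (inj₁ ss≤q) = square-cancel-≤ 0≤α (≤-respˡ (sym (eq β s)) (ℚ.≤-trans (≤-*ˡ {s * s} {q} {β * β} (0≤* 0≤β 0≤β) ss≤q) h))
    go s (inj₂ refl) = ≤-respˡ (sym (ℚ.*-zeroʳ β)) 0≤α

  -- M is the number of elements, p an approximation of π, and A the largest element.
  peak-bound : ∀ {B M K K₂ A p} i → 0ℚ ≤ B → 0ℚ < M → 0ℚ < K → 0ℚ < K₂ → 0ℚ ≤ A → ι 9 ≤ ι 4 * p →
    ι 3 * (B * B) ≤ ι 4 * (K * K₂ * (M * (A * A))) →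
    (ι 1 + 0ℚ) * (B * recip (ι 2)) * sqrtApprox (ι 6 * recip (M * p * K * K₂)) i ≤ A
  peak-bound {B} {M} {K} {K₂} {A} {p} i 0≤B 0<M 0<K 0<K₂ 0≤A 9≤4p h =
    scaled-sqrt≤ i (0≤* {ι 1 + 0ℚ} (0≤ι 1) (0≤* 0≤B (ℚ.<⇒≤ (recip-pos (0<ι 1))))) 0≤A
      (cancelʳ-≤ {c = ι 4 * D} (0<* (0<ι 3) 0<D) (begin
        (ι 1 + 0ℚ) * (B * r) * ((ι 1 + 0ℚ) * (B * r)) * (ι 6 * s) * (ι 4 * D)
          ≡⟨ eq₁ B r s D ⟩
        ι 6 * (B * B) * ((ι 2 * r) * (ι 2 * r) * (D * s))
          ≡⟨ cong₂ (λ u v → ι 6 * (B * B) * (u * u * v)) (recip-inverse (0<ι 1)) (recip-inverse 0<D) ⟩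
        ι 6 * (B * B) * (1ℚ * 1ℚ * 1ℚ)
          ≡⟨ eq₂ B ⟩
        ι 2 * (ι 3 * (B * B))
          ≤⟨ ≤-*ˡ {ι 3 * (B * B)} {ι 4 * W} {ι 2} (0≤ι 2) h ⟩
        ι 2 * (ι 4 * W)
          ≡⟨ eq₃ W ⟩
        ι 8 * W
          -- After the factor 4/3 spent on the +1 it remains to have π ≥ 2, which 9 ≤ 4 p supplies.
          ≤⟨ ≤-*ʳ {ι 8} {ι 4 * p} {W} 0≤W (ℚ.≤-trans (ι-mono-≤ (ℕ.n≤1+n 8)) 9≤4p) ⟩
        ι 4 * p * W
          ≡⟨ eq₄ M K K₂ A p ⟩
        A * A * (ι 4 * D) ∎))
    where
    open ℚ.≤-Reasoning
    D = M * p * K * K₂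
    W = K * K₂ * (M * (A * A))
    r = recip (ι 2)
    s = recip D
    0<p : 0ℚ < p
    0<p = ℚ.*-cancelˡ-<-nonNeg (ι 4) (ℚ.<-≤-trans (0<ι 8) 9≤4p)
    0<D : 0ℚ < D
    0<D = 0<* (0<* (0<* 0<M 0<p) 0<K) 0<K₂
    0≤W : 0ℚ ≤ W
    0≤W = 0≤* (0≤* (ℚ.<⇒≤ 0<K) (ℚ.<⇒≤ 0<K₂)) (0≤* (ℚ.<⇒≤ 0<M) (0≤* 0≤A 0≤A))
    eq₁ : ∀ B r s D → (ι 1 + 0ℚ) * (B * r) * ((ι 1 + 0ℚ) * (B * r)) * (ι 6 * s) * (ι 4 * D) ≡ ι 6 * (B * B) * ((ι 2 * r) * (ι 2 * r) * (D * s))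
    eq₁ = solve-∀ ring
    eq₂ : ∀ B → ι 6 * (B * B) * (1ℚ * 1ℚ * 1ℚ) ≡ ι 2 * (ι 3 * (B * B))
    eq₂ = solve-∀ ring
    eq₃ : ∀ W → ι 2 * (ι 4 * W) ≡ ι 8 * W
    eq₃ = solve-∀ ring
    eq₄ : ∀ M K K₂ A p → ι 4 * p * (K * K₂ * (M * (A * A))) ≡ A * A * (ι 4 * (M * p * K * K₂))
    eq₄ = solve-∀ ring

  logNumerator≥ : ∀ n l i → 2 ℕ.^ l ℕ.≤ n → l ℕ.* suc i ℕ.≤ logNumerator 2 (ι n) i
  logNumerator≥ n l i 2^l≤n = greatest-max (λ p → ι (2 ℕ.^ p) ℚ.≤? (1ℚ ⊔ ι n) ^ℚ suc i)
    -- The exponent lies in the search range of `logNumerator`: an exponent p is below 2^p, and a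
    -- rational is at most its numerator.
    (ℕ.≤-trans (ℕ.<⇒≤ (Log.n<b^n 2 ℕ.≤-refl (l ℕ.* suc i))) (ι-cancel-≤ (ℚ.≤-trans 2^≤ (≤-numerator ((1ℚ ⊔ ι n) ^ℚ suc i))))) 2^≤
    where
    2^≤ : ι (2 ℕ.^ (l ℕ.* suc i)) ≤ (1ℚ ⊔ ι n) ^ℚ suc i
    2^≤ = ≤-respˡ (trans (sym (ι-^ (2 ℕ.^ l) (suc i))) (cong ι (ℕ.^-*-assoc 2 l (suc i))))
      (^-mono (suc i) (0≤ι (2 ℕ.^ l)) (ℚ.≤-trans (ι-mono-≤ 2^l≤n) (ℚ.p≤q⊔p 1ℚ (ι n))))

  module _ {b : ℕ} (1<b : 1 ℕ.< b) where

    open Log b 1<b using (n<b^n; lower; upper; b^-cancel-≤)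

    logNumerator≡0 : ∀ {q} i → q ≤ 1ℚ → logNumerator b q i ≡ 0
    logNumerator≡0 {q} i q≤1 = ℕ.n<1⇒n≡0 (ℕ.<-≤-trans (n<b^n (logNumerator b q i)) (ι-cancel-≤ (ℚ.≤-trans (lower q i)
      (ℚ.≤-reflexive (trans (cong (_^ℚ suc i) (ℚ.p≥q⇒p⊔q≡p q≤1)) (Exp-1 (suc i)))))))
      where
      Exp-1 : ∀ n → 1ℚ ^ℚ n ≡ 1ℚ
      Exp-1 zero = refl
      Exp-1 (suc n) = trans (ℚ.*-identityˡ (1ℚ ^ℚ n)) (Exp-1 n)

    -- For arguments ≥ 1 the term log⁺ b (1 / x) in the definition of log b x is identically 0.
    log-≥1 : ∀ {q} i → 1ℚ ≤ q → logApprox b q i - logApprox b (recip q) i ≡ logApprox b q i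
    log-≥1 {q} i 1≤q = go (logNumerator≡0 i (Log₂.recip≤1 q 1≤q))
      where
      go : ∀ {p′} → p′ ≡ 0 → logApprox b q i - (+ p′ / suc i) ≡ logApprox b q i
      go refl = trans (cong (λ u → logApprox b q i - u) (ℚ.0/n≡0 (suc i))) (ℚ.+-identityʳ (logApprox b q i))

    upper′ : ∀ {q} i → 0ℚ ≤ q → q ^ℚ suc i ≤ ι (b ℕ.^ suc (logNumerator b q i))
    upper′ {q} i 0≤q = ℚ.≤-trans (^-mono (suc i) 0≤q (ℚ.p≤q⊔p 1ℚ q)) (upper q i)

    -- Raise the hypothesis to the power i + 1 and compare exponents of b. Each of the four
    -- rounded-down numerators may fall short by up to 1, hence the 4.
    log-numerators : ∀ {x y z} c i → 0ℚ ≤ x → 0ℚ ≤ y → 0ℚ ≤ z →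
      ι (b ℕ.^ c ℕ.* b ℕ.^ c) ≤ (x * x) * (y * z) →
      (c ℕ.+ c) ℕ.* suc i ℕ.≤ (logNumerator b x i ℕ.+ logNumerator b x i) ℕ.+ (logNumerator b y i ℕ.+ logNumerator b z i) ℕ.+ 4
    log-numerators {x} {y} {z} c i 0≤x 0≤y 0≤z h = ℕ.≤-trans (b^-cancel-≤ (ι-cancel-≤ (begin
      ι (b ℕ.^ ((c ℕ.+ c) ℕ.* m))
        ≡⟨ cong ι (trans (cong (ℕ._^ m) (sym (ℕ.^-distribˡ-+-* b c c))) (ℕ.^-*-assoc b (c ℕ.+ c) m)) ⟨
      ι ((b ℕ.^ c ℕ.* b ℕ.^ c) ℕ.^ m)
        ≡⟨ ι-^ (b ℕ.^ c ℕ.* b ℕ.^ c) m ⟩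
      ι (b ℕ.^ c ℕ.* b ℕ.^ c) ^ℚ m
        ≤⟨ ^-mono m (0≤ι (b ℕ.^ c ℕ.* b ℕ.^ c)) h ⟩
      ((x * x) * (y * z)) ^ℚ m
        ≡⟨ trans (Exp.^-distrib-* (x * x) (y * z) m) (cong₂ _*_ (Exp.^-distrib-* x x m) (Exp.^-distrib-* y z m)) ⟩
      (x ^ℚ m * x ^ℚ m) * (y ^ℚ m * z ^ℚ m)
        ≤⟨ ≤-* {x ^ℚ m * x ^ℚ m} {P * P} {y ^ℚ m * z ^ℚ m} {Q * R} (0≤* (^-nonNeg m 0≤y) (^-nonNeg m 0≤z)) (0≤* 0≤P 0≤P)
             (≤-* {x ^ℚ m} {P} {x ^ℚ m} {P} (^-nonNeg m 0≤x) 0≤P (upper′ i 0≤x) (upper′ i 0≤x))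
             (≤-* {y ^ℚ m} {Q} {z ^ℚ m} {R} (^-nonNeg m 0≤z) (0≤ι _) (upper′ i 0≤y) (upper′ i 0≤z)) ⟩
      (P * P) * (Q * R)
        ≡⟨ trans (ι-* (b ℕ.^ suc p ℕ.* b ℕ.^ suc p) (b ℕ.^ suc q ℕ.* b ℕ.^ suc r))
             (cong₂ _*_ (ι-* (b ℕ.^ suc p) (b ℕ.^ suc p)) (ι-* (b ℕ.^ suc q) (b ℕ.^ suc r))) ⟨
      ι ((b ℕ.^ suc p ℕ.* b ℕ.^ suc p) ℕ.* (b ℕ.^ suc q ℕ.* b ℕ.^ suc r))
        ≡⟨ cong ι (trans (ℕ.^-distribˡ-+-* b (suc p ℕ.+ suc p) (suc q ℕ.+ suc r))
             (cong₂ ℕ._*_ (ℕ.^-distribˡ-+-* b (suc p) (suc p)) (ℕ.^-distribˡ-+-* b (suc q) (suc r)))) ⟨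
      ι (b ℕ.^ ((suc p ℕ.+ suc p) ℕ.+ (suc q ℕ.+ suc r))) ∎)))
      (ℕ.≤-reflexive (eq p q r))
      where
      open ℚ.≤-Reasoning
      m = suc i
      p = logNumerator b x i
      q = logNumerator b y i
      r = logNumerator b z i
      P = ι (b ℕ.^ suc p)
      Q = ι (b ℕ.^ suc q)
      R = ι (b ℕ.^ suc r)
      0≤P : 0ℚ ≤ P
      0≤P = 0≤ι (b ℕ.^ suc p)
      eq : ∀ p q r → (suc p ℕ.+ suc p) ℕ.+ (suc q ℕ.+ suc r) ≡ (p ℕ.+ p) ℕ.+ (q ℕ.+ r) ℕ.+ 4
      eq = ℕ-Solver.solve-∀

    -- Division by 2 (i + 1) turns the rounding loss 4 into 2 / (i + 1), which vanishes in the
    -- limit.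
    quotients : ∀ c p q r i → (c ℕ.+ c) ℕ.* suc i ℕ.≤ (p ℕ.+ p) ℕ.+ (q ℕ.+ r) ℕ.+ 4 →
      ι c ≤ (+ p / suc i) + ½ * (+ q / suc i) + ½ * (+ r / suc i) + ι 2 * (+ 1 / suc i)
    quotients c p q r i h = cancelʳ-≤ {c = ι 2 * m} (0<* (0<ι 1) (0<ι i)) (begin
      ι c * (ι 2 * m)
        ≡⟨ eq₁ (ι c) m ⟩
      (ι c + ι c) * m
        ≡⟨ trans (ι-* (c ℕ.+ c) (suc i)) (cong (_* m) (ι-+ c c)) ⟨
      ι ((c ℕ.+ c) ℕ.* suc i)
        ≤⟨ ι-mono-≤ h ⟩
      ι ((p ℕ.+ p) ℕ.+ (q ℕ.+ r) ℕ.+ 4)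
        ≡⟨ trans (ι-+ ((p ℕ.+ p) ℕ.+ (q ℕ.+ r)) 4) (cong (_+ ι 4)
             (trans (ι-+ (p ℕ.+ p) (q ℕ.+ r)) (cong₂ _+_ (ι-+ p p) (ι-+ q r)))) ⟩
      (ι p + ι p) + (ι q + ι r) + ι 4
        ≡⟨ cong₂ (λ u v → (u + u) + v + ι 4) (/-cancel p i) (cong₂ _+_ (/-cancel q i) (/-cancel r i)) ⟨
      (lp * m + lp * m) + (lq * m + lr * m) + ι 4 * ι 1
        ≡⟨ cong (λ u → (lp * m + lp * m) + (lq * m + lr * m) + ι 4 * u) (/-cancel 1 i) ⟨
      (lp * m + lp * m) + (lq * m + lr * m) + ι 4 * (u * m)
        ≡⟨ eq₂ lp lq lr u m ⟩
      (lp + ½ * lq + ½ * lr + ι 2 * u) * (ι 2 * m) ∎)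
      where
      open ℚ.≤-Reasoning
      m = ι (suc i)
      lp = + p / suc i
      lq = + q / suc i
      lr = + r / suc i
      u = + 1 / suc i
      eq₁ : ∀ c m → c * (ι 2 * m) ≡ (c + c) * m
      eq₁ = solve-∀ ring
      eq₂ : ∀ lp lq lr u m → (lp * m + lp * m) + (lq * m + lr * m) + ι 4 * (u * m) ≡ (lp + ½ * lq + ½ * lr + ι 2 * u) * (ι 2 * m)
      eq₂ = solve-∀ ring

    log-bound : ∀ {x y z} c i → 0ℚ ≤ x → 0ℚ ≤ y → 0ℚ ≤ z → ι (b ℕ.^ c ℕ.* b ℕ.^ c) ≤ (x * x) * (y * z) →
      ι c ≤ logApprox b x i + ½ * logApprox b y i + ½ * logApprox b z i + ι 2 * (+ 1 / suc i)
    log-bound {x} {y} {z} c i 0≤x 0≤y 0≤z h =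
      quotients c (logNumerator b x i) (logNumerator b y i) (logNumerator b z i) i (log-numerators c i 0≤x 0≤y 0≤z h)

-- Both estimates at the level of rational approximations.

module Bounds where

  open import Data.Fin.Base using (Fin; fromℕ)
  import Data.Fin.Base as Fin
  import Data.Fin.Properties as Fin
  open import Data.Integer.Base using (+_)
  open import Data.List.Base using (tabulate)
  import Data.List.Properties as List
  import Data.List.Relation.Unary.All.Properties as All
  import Data.List.Relation.Unary.Unique.Propositional.Properties as Unique
  open import Data.Nat.Base as ℕ using (ℕ; suc; s≤s)
  import Data.Nat.Properties as ℕ
  open import Data.Product.Base using (_×_; _,_)
  open import Data.Rational.Base as ℚ using (ℚ; 0ℚ; 1ℚ; ½)
  import Data.Rational.Properties as ℚ
  open import Data.Sum.Base using (_⊎_; inj₁; inj₂)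
  open import Data.Vec.Functional using (Vector; last)
  open import Defs using (module Rational; module Sequence; Is𝒟; Image)
  open import Relation.Binary.Core using (_Preserves_⟶_)
  open import Relation.Binary.Definitions using (tri<; tri≈; tri>)
  open import Relation.Binary.PropositionalEquality
  open import Relation.Nullary using (yes; no; contradiction)
  open import Tactic.RingSolver using (solve-∀)
  open Rational
  open Sequence using (logApprox; logNumerator; module Cauchy; module Log₂)
  open Cauchy using (recip; recip-inverse)
  open Combinatorics using (𝒟-bound)
  open Arithmetic using (3*square≤4*)
  open Approximation

  ι-k[k+2] : ∀ k → ι (k ℕ.* (k ℕ.+ 2)) ≡ ι k * (ι k + ι 2)
  ι-k[k+2] k = trans (ι-* k (k ℕ.+ 2)) (cong (ι k *_) (ι-+ k 2))

  module _ {m} {a : Vector ℕ (suc m)} (a↗ : a Preserves Fin._<_ ⟶ ℕ._<_) where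

    increasing⇒injective : ∀ {i j} → a i ≡ a j → i ≡ j
    increasing⇒injective {i} {j} ai≡aj with Fin.<-cmp i j
    ... | tri< i<j _ _ = contradiction ai≡aj (ℕ.<⇒≢ (a↗ i<j))
    ... | tri≈ _ i≡j _ = i≡j
    ... | tri> _ _ j<i = contradiction (sym ai≡aj) (ℕ.<⇒≢ (a↗ j<i))

    increasing⇒≤last : ∀ i → a i ℕ.≤ last a
    increasing⇒≤last i with Fin.<-cmp i (fromℕ m)
    ... | tri< i<m _ _ = ℕ.<⇒≤ (a↗ i<m)
    ... | tri≈ _ refl _ = ℕ.≤-refl
    ... | tri> _ _ m<i = contradiction (Fin.≤fromℕ i) (ℕ.<⇒≱ m<i)

    last-bound : ∀ {k} → 1 ℕ.≤ k → Is𝒟 k (Image a) →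
      3 ℕ.* (suc k ℕ.^ suc m ℕ.* suc k ℕ.^ suc m) ℕ.≤ 4 ℕ.* (k ℕ.* (k ℕ.+ 2) ℕ.* (suc m ℕ.* (last a ℕ.* last a)))
    last-bound {k} 1≤k 𝒟 = 3*square≤4* {suc k ℕ.^ suc m} {k ℕ.* (k ℕ.+ 2) ℕ.* (suc m ℕ.* (last a ℕ.* last a))}
      (ℕ.*-mono-≤ {2} {suc k} {1} {suc k ℕ.^ m} (s≤s 1≤k) (ℕ.m^n>0 (suc k) m))
      (subst (λ n → suc k ℕ.^ n ℕ.* suc k ℕ.^ n ℕ.≤ k ℕ.* (k ℕ.+ 2) ℕ.* (n ℕ.* (last a ℕ.* last a)) ℕ.+ 1)
        (List.length-tabulate a)
        (𝒟-bound {k} {Image a} 𝒟 {last a} (tabulate a) (Unique.tabulate⁺ increasing⇒injective)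
          (All.tabulate⁺ (λ i → i , refl)) (All.tabulate⁺ increasing⇒≤last)))

    ι-last-bound : ∀ {k} → 1 ℕ.≤ k → Is𝒟 k (Image a) →
      ι 3 * (ι (suc k ℕ.^ suc m) * ι (suc k ℕ.^ suc m)) ≤
      ι 4 * (ι k * (ι k + ι 2) * (ι (suc m) * (ι (last a) * ι (last a))))
    ι-last-bound {k} 1≤k 𝒟 = subst₂ _≤_
      (trans (ι-* 3 (B ℕ.* B)) (cong (ι 3 *_) (ι-* B B)))
      (trans (ι-* 4 (K ℕ.* (M ℕ.* (A ℕ.* A)))) (cong (ι 4 *_) (trans (ι-* K (M ℕ.* (A ℕ.* A))) (cong₂ _*_ (ι-k[k+2] k)
        (trans (ι-* M (A ℕ.* A)) (cong (ι M *_) (ι-* A A)))))))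
      (ι-mono-≤ (last-bound 1≤k 𝒟))
      where
      B = suc k ℕ.^ suc m
      K = k ℕ.* (k ℕ.+ 2)
      M = suc m
      A = last a

  logApprox≥ : ∀ n l i → 2 ℕ.^ l ℕ.≤ n → ι l ≤ logApprox 2 (ι n) i
  logApprox≥ n l i 2^l≤n = cancelʳ-≤ {c = ι (suc i)} (0<ι i)
    (subst₂ _≤_ (ι-* l (suc i)) (sym (/-cancel (logNumerator 2 (ι n) i) i)) (ι-mono-≤ (logNumerator≥ n l i 2^l≤n)))

  -- This is (2π/3) k (k + 2) at the approximation p of π, bracketed as the real operations unfold,
  -- so that `refl` identifies it with a term of the real constant.
  constant : ℕ → ℚ → ℚ
  constant k p = ι 2 * p * recip (ι 3) * ι k * (ι k + ι 2)

  constant≥ : ∀ k {p} → ι 9 ≤ ι 4 * p → ι 3 * (ι k * (ι k + ι 2)) ≤ ι 2 * constant k p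
  constant≥ k {p} 9≤4p = cancelʳ-≤ {c = ι 3} (0<ι 2) (begin
    ι 3 * (ι k * (ι k + ι 2)) * ι 3        ≡⟨ eq₁ (ι k) ⟩
    ι 9 * (ι k * (ι k + ι 2))              ≤⟨ ≤-*ʳ (0≤* (0≤ι k) (ℚ.+-mono-≤ (0≤ι k) (0≤ι 2))) 9≤4p ⟩
    ι 4 * p * (ι k * (ι k + ι 2))          ≡⟨ ℚ.*-identityʳ _ ⟨
    ι 4 * p * (ι k * (ι k + ι 2)) * 1ℚ     ≡⟨ cong (ι 4 * p * (ι k * (ι k + ι 2)) *_) (recip-inverse (0<ι 2)) ⟨
    ι 4 * p * (ι k * (ι k + ι 2)) * (ι 3 * recip (ι 3))  ≡⟨ eq₂ (ι k) p (recip (ι 3)) ⟩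
    ι 2 * constant k p * ι 3               ∎)
    where
    open ℚ.≤-Reasoning
    eq₁ : ∀ K → ι 3 * (K * (K + ι 2)) * ι 3 ≡ ι 9 * (K * (K + ι 2))
    eq₁ = solve-∀ ring
    eq₂ : ∀ K p r → ι 4 * p * (K * (K + ι 2)) * (ι 3 * r) ≡ ι 2 * (ι 2 * p * r * K * (K + ι 2)) * ι 3
    eq₂ = solve-∀ ring

  -- Reduces to 2 ≤ 3 k (k + 2). It makes `log-≥1` applicable to the constant.
  1≤constant : ∀ {k p} → 1 ℕ.≤ k → ι 9 ≤ ι 4 * p → 1ℚ ≤ constant k p
  1≤constant {k} {p} 1≤k 9≤4p = ℚ.*-cancelˡ-≤-pos (ι 2) (ℚ.≤-trans
    (≤-* {ι 2} {ι 3} {1ℚ} {ι k * (ι k + ι 2)} (0≤ι 1) (0≤ι 3) (ι-mono-≤ (ℕ.n≤1+n 2))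
      (≤-* {1ℚ} {ι k} {1ℚ} {ι k + ι 2} (0≤ι 1) (0≤ι k) (ι-mono-≤ 1≤k)
        (subst (1ℚ ≤_) (ι-+ k 2) (ι-mono-≤ (ℕ.≤-trans 1≤k (ℕ.m≤m+n k 2))))))
    (constant≥ k {p} 9≤4p))

  -- The integer part l of log₂ n gives way to an approximation y of log₂ n, and (3/2) k (k + 2) to
  -- the larger z.
  product-bound : ∀ {k n l b y z} → 2 ℕ.* b ℕ.≤ 3 ℕ.* l ℕ.* (k ℕ.* (k ℕ.+ 2) ℕ.* (n ℕ.* n)) →
    ι l ≤ y → 0ℚ ≤ z → ι 3 * (ι k * (ι k + ι 2)) ≤ ι 2 * z → ι b ≤ (ι n * ι n) * (y * z)
  product-bound {k} {n} {l} {b} {y} {z} h l≤y 0≤z K≤z = ℚ.*-cancelˡ-≤-pos (ι 2) (begin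
    ι 2 * ι b                                   ≡⟨ ι-* 2 b ⟨
    ι (2 ℕ.* b)                                 ≤⟨ ι-mono-≤ h ⟩
    ι (3 ℕ.* l ℕ.* (k ℕ.* (k ℕ.+ 2) ℕ.* (n ℕ.* n)))
      ≡⟨ trans (ι-* (3 ℕ.* l) (k ℕ.* (k ℕ.+ 2) ℕ.* (n ℕ.* n))) (cong₂ _*_ (ι-* 3 l)
           (trans (ι-* (k ℕ.* (k ℕ.+ 2)) (n ℕ.* n)) (cong₂ _*_ (ι-k[k+2] k) (ι-* n n)))) ⟩
    ι 3 * ι l * (ι k * (ι k + ι 2) * (ι n * ι n))  ≡⟨ eq₁ (ι l) (ι k * (ι k + ι 2)) (ι n * ι n) ⟩
    (ι n * ι n) * (ι l * (ι 3 * (ι k * (ι k + ι 2))))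
      ≤⟨ ≤-*ˡ (0≤* (0≤ι n) (0≤ι n)) (≤-* (0≤* {ι 3} (0≤ι 3) (0≤* (0≤ι k) (ℚ.+-mono-≤ (0≤ι k) (0≤ι 2)))) (ℚ.≤-trans (0≤ι l) l≤y) l≤y K≤z) ⟩
    (ι n * ι n) * (y * (ι 2 * z))               ≡⟨ eq₂ (ι n * ι n) y z ⟩
    ι 2 * ((ι n * ι n) * (y * z))               ∎)
    where
    open ℚ.≤-Reasoning
    eq₁ : ∀ L K N → ι 3 * L * (K * N) ≡ N * (L * (ι 3 * K))
    eq₁ = solve-∀ ring
    eq₂ : ∀ N y z → N * (y * (ι 2 * z)) ≡ ι 2 * (N * (y * z))
    eq₂ = solve-∀ ring

  -- The o(1) term of the second estimate: below 512 it covers the counts up to 12 that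
  -- `few-or-absorbed` leaves over.
  slack : ℕ → ℕ
  slack n with n ℕ.<? 512
  ... | yes _ = 12
  ... | no _ = 0

  slack-small : ∀ {n} → n ℕ.< 512 → slack n ≡ 12
  slack-small {n} n<512 with n ℕ.<? 512
  ... | yes _ = refl
  ... | no n≮512 = contradiction n<512 n≮512

  slack-large : ∀ {n} → 512 ℕ.≤ n → slack n ≡ 0
  slack-large {n} 512≤n with n ℕ.<? 512
  ... | yes n<512 = contradiction 512≤n (ℕ.<⇒≱ n<512)
  ... | no _ = refl

  logDifference : ℕ → ℚ → ℕ → ℚ
  logDifference b q i = logApprox b q i - logApprox b (recip q) i

  ≤-insert : ∀ {q t u} s → 0ℚ ≤ s → q ≤ t + u → q ≤ t + s + u
  ≤-insert {q} {t} {u} s 0≤s q≤ = ℚ.≤-trans q≤ (ℚ.+-monoˡ-≤ u (≤-respˡ (ℚ.+-identityʳ t) (ℚ.+-monoʳ-≤ t 0≤s)))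

  ≤-surround : ∀ {q s} t u → 0ℚ ≤ t → 0ℚ ≤ u → q ≤ s → q ≤ t + s + u
  ≤-surround {q} {s} t u 0≤t 0≤u q≤s =
    ≤-respˡ (trans (ℚ.+-identityʳ (0ℚ + q)) (ℚ.+-identityˡ q)) (ℚ.+-mono-≤ (ℚ.+-mono-≤ 0≤t q≤s) 0≤u)

  -- If c ≤ s, nonnegative logarithms can be added freely; otherwise s ≥ 0 is inserted into a sum
  -- that already bounds c.
  log-sum-bound : ∀ {b} → 1 ℕ.< b → ∀ {x y z s u} c i → 1ℚ ≤ x → 1ℚ ≤ y → 1ℚ ≤ z → 0ℚ ≤ s → 0ℚ ≤ u →
    ι c ≤ s ⊎ ι c ≤ logApprox b x i + ½ * logApprox b y i + ½ * logApprox b z i + u →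
    ι c ≤ logDifference b x i + ½ * logDifference b y i + ½ * logDifference b z i + s + u
  log-sum-bound {b} 1<b {x} {y} {z} {s} {u} c i 1≤x 1≤y 1≤z 0≤s 0≤u h =
    go (log-≥1 1<b {x} i 1≤x) (log-≥1 1<b {y} i 1≤y) (log-≥1 1<b {z} i 1≤z) (0≤log x) (0≤log y) (0≤log z) h
    where
    0≤log : ∀ q → 0ℚ ≤ logApprox b q i
    0≤log q = Sequence.0≤/ (logNumerator b q i) i
    go : ∀ {q X Y Z X′ Y′ Z′} → X′ ≡ X → Y′ ≡ Y → Z′ ≡ Z → 0ℚ ≤ X → 0ℚ ≤ Y → 0ℚ ≤ Z →
         q ≤ s ⊎ q ≤ X + ½ * Y + ½ * Z + u → q ≤ X′ + ½ * Y′ + ½ * Z′ + s + u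
    go {q} {X} {Y} {Z} refl refl refl 0≤X 0≤Y 0≤Z (inj₁ q≤s) = ≤-surround (X + ½ * Y + ½ * Z) u
      (ℚ.+-mono-≤ (ℚ.+-mono-≤ 0≤X (0≤* (ℚ.<⇒≤ 0<½) 0≤Y)) (0≤* (ℚ.<⇒≤ 0<½) 0≤Z)) 0≤u q≤s
    go {q} {X} {Y} {Z} refl refl refl _ _ _ (inj₂ q≤) = ≤-insert {q} {X + ½ * Y + ½ * Z} {u} s 0≤s q≤

  log-count : ∀ {k c n l y z ε} i → ι 2 * (+ 1 / suc i) ≤ ε → 1 ℕ.≤ k → 1ℚ ≤ y → 1ℚ ≤ z → ι l ≤ y → ι 3 * (ι k * (ι k + ι 2)) ≤ ι 2 * z →
    (c ℕ.≤ 12 × n ℕ.< 512) ⊎ 2 ℕ.* (suc k ℕ.^ c ℕ.* suc k ℕ.^ c) ℕ.≤ 3 ℕ.* l ℕ.* (k ℕ.* (k ℕ.+ 2) ℕ.* (n ℕ.* n)) →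
    ι c ≤ ι (slack n) ⊎ ι c ≤ logApprox (suc k) (ι n) i + ½ * logApprox (suc k) y i + ½ * logApprox (suc k) z i + ε
  log-count i _ 1≤k 1≤y 1≤z l≤y K≤z (inj₁ (c≤12 , n<512)) =
    inj₁ (ι-mono-≤ (ℕ.≤-trans c≤12 (ℕ.≤-reflexive (sym (slack-small n<512)))))
  log-count {k} {c} {n} {l} {y} {z} i 2/≤ε 1≤k 1≤y 1≤z l≤y K≤z (inj₂ h) =
    inj₂ (ℚ.≤-trans (log-bound (s≤s 1≤k) {ι n} {y} {z} c i (0≤ι n) (0≤ 1≤y) (0≤ 1≤z)
      (product-bound {k} {n} {l} {suc k ℕ.^ c ℕ.* suc k ℕ.^ c} {y} {z} h l≤y (0≤ 1≤z) K≤z))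
      (ℚ.+-monoʳ-≤ (logApprox (suc k) (ι n) i + ½ * logApprox (suc k) y i + ½ * logApprox (suc k) z i) 2/≤ε))
    where
    0≤ : ∀ {q} → 1ℚ ≤ q → 0ℚ ≤ q
    0≤ = ℚ.≤-trans (0≤ι 1)

  -- The terms x, y, z, s are tied to their values by equations, so that terms of real sequences can
  -- be supplied with `refl`.
  count-bound : ∀ {k c n l p x y z s ε} i → x ≡ ι n → y ≡ logDifference 2 (ι n) i → z ≡ constant k p → s ≡ ι (slack n) → 0ℚ ≤ ε → ι 2 * (+ 1 / suc i) ≤ ε → 1 ℕ.≤ k → 2 ℕ.≤ n → 2 ℕ.^ l ℕ.≤ n → ι 9 ≤ ι 4 * p →
    (c ℕ.≤ 12 × n ℕ.< 512) ⊎ 2 ℕ.* (suc k ℕ.^ c ℕ.* suc k ℕ.^ c) ℕ.≤ 3 ℕ.* l ℕ.* (k ℕ.* (k ℕ.+ 2) ℕ.* (n ℕ.* n)) →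
    ι c ≤ logDifference (suc k) x i + ½ * logDifference (suc k) y i + ½ * logDifference (suc k) z i + s + ε
  count-bound {k} {c} {n} {l} {p} {ε = ε} i refl refl refl refl 0≤ε 2/≤ε 1≤k 2≤n 2^l≤n 9≤4p h =
    log-sum-bound (s≤s 1≤k) {ι n} {logDifference 2 (ι n) i} {constant k p} {ι (slack n)} {ε} c i
      1≤n (Log₂.1≤log n i 2≤n) (1≤constant {k} {p} 1≤k 9≤4p) (0≤ι (slack n)) 0≤ε
      (log-count {k} {c} {n} {l} {logDifference 2 (ι n) i} {constant k p} {ε} i 2/≤ε 1≤k
        (Log₂.1≤log n i 2≤n) (1≤constant {k} {p} 1≤k 9≤4p)
        (ℚ.≤-trans (logApprox≥ n l i 2^l≤n) (ℚ.≤-reflexive (sym (log-≥1 {2} ℕ.≤-refl {ι n} i 1≤n))))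
        (constant≥ k {p} 9≤4p) h)
    where
    1≤n : 1ℚ ≤ ι n
    1≤n = ι-mono-≤ (ℕ.<⇒≤ 2≤n)

-- Passage to real numbers.

open import Defs
open import Data.Fin.Base using (Fin)
import Data.Fin.Base as Fin
open import Data.Nat.Base using (ℕ; suc; _^_; NonZero; NonTrivial; nonTrivial⇒nonZero)
import Data.Nat.Base as ℕ
open import Data.Nat.InfinitelyOften using (Inf)
open import Data.Product.Base using (_×_; ∃-syntax)
open import Data.Rational.Base using (½)
open import Data.Vec.Functional using (Vector; last)
open import Level using (0ℓ)
open import Relation.Binary.Core using (_Preserves_⟶_)
open import Relation.Unary using (Pred)

open import Data.List.Relation.Unary.All using (tabulate)
import Data.Nat.Properties as ℕ
open import Data.Product.Base using (_,_; proj₁; proj₂)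
import Data.Rational.Base as ℚ
import Data.Rational.Properties as ℚ
open import Data.Sum.Base using (_⊎_)
open import Function.Bundles using (Equivalence)
open import Relation.Binary.PropositionalEquality using (_≡_; refl; sym; trans; subst)
open Approximation using (π≥9/4; peak-bound)
open Arithmetic using (log₂-floor; few-or-absorbed)
open Bounds using (constant; count-bound; logDifference; slack; slack-large; ι-last-bound)
open Combinatorics using (𝒟-bound)
open Sequence using (sqrtApprox)
open Sequence.Cauchy using (recip)
open Rational using (ι; 0≤ι; 0<ι; 0<+; half; ≤-*ˡ; ι-mono-<)

private

  0-within : ∀ {ε} → ℚ.0ℚ ℚ.< ε → - fromℚ ε ≤ fromℕ 0 × fromℕ 0 ≤ fromℚ ε
  0-within {ε} 0<ε =
    (λ δ 0<δ → 0 , λ _ _ → ℚ.≤-trans (ℚ.neg-antimono-≤ (ℚ.<⇒≤ 0<ε)) (ℚ.≤-trans (ℚ.<⇒≤ 0<δ) (ℚ.≤-reflexive (sym (ℚ.+-identityˡ δ))))) ,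
    (λ δ 0<δ → 0 , λ _ _ → ℚ.<⇒≤ (0<+ 0<ε 0<δ))

  vanishes-zero : Vanishes (λ _ → fromℕ 0)
  vanishes-zero ε 0<ε = 0 , λ _ _ → 0-within 0<ε

  vanishes-slack : Vanishes (λ n → fromℕ (slack n))
  vanishes-slack ε 0<ε = 512 , λ n 512≤n →
    subst (λ s → - fromℚ ε ≤ fromℕ s × fromℕ s ≤ fromℚ ε) (sym (slack-large 512≤n)) (0-within 0<ε)

  peak-bound-ℝ : ∀ {B M K A : ℕ} {D : ℝ} {{_ : Positive D}} i → (∀ j → seq D j ≡ ι M ℚ.* seq π j ℚ.* ι K ℚ.* (ι K ℚ.+ ι 2)) →
    ℚ.0ℚ ℚ.< ι M → ℚ.0ℚ ℚ.< ι K → ι 9 ℚ.≤ ι 4 ℚ.* seq π i →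
    ι 3 ℚ.* (ι B ℚ.* ι B) ℚ.≤ ι 4 ℚ.* (ι K ℚ.* (ι K ℚ.+ ι 2) ℚ.* (ι M ℚ.* (ι A ℚ.* ι A))) →
    seq ((fromℕ 1 + fromℕ 0) * (fromℕ B / fromℕ 2) * √ (fromℕ 6 / D)) i ℚ.≤ ι A
  peak-bound-ℝ {B} {M} {K} {A} i D≡ 0<M 0<K 9≤4π h =
    subst (λ d → (ι 1 ℚ.+ ℚ.0ℚ) ℚ.* (ι B ℚ.* recip (ι 2)) ℚ.* sqrtApprox (ι 6 ℚ.* recip d) i ℚ.≤ ι A) (sym (D≡ i))
      (peak-bound {ι B} {ι M} {ι K} {ι K ℚ.+ ι 2} {ι A} {seq π i} i (0≤ι B) 0<M 0<K (0<+ {ι K} {ι 2} 0<K (0<ι 1)) (0≤ι A) 9≤4π h)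

  -- Unlike fromℕ c ≤ x, the type c ⊑ x determines x up to conversion, so that x can be inferred from it
  -- without unfolding the sequence of rational approximations.
  record _⊑_ (c : ℕ) (x : ℝ) : Set where
    constructor ⊑-intro
    field
      ⊑⇒≤ : fromℕ c ≤ x

  open _⊑_

  twice≤ : ∀ {q ε} → q ℚ.≤ ½ ℚ.* ε → ι 2 ℚ.* q ℚ.≤ ε
  twice≤ {q} {ε} q≤ = ℚ.≤-trans (≤-*ˡ {q} {½ ℚ.* ε} (0≤ι 2) q≤)
    (ℚ.≤-reflexive (trans (sym (ℚ.*-assoc (ι 2) ½ ε)) (ℚ.*-identityˡ ε)))

  count-bound-ℝ : ∀ {k c n l} .{{_ : NonTrivial (suc k)}} {x y z e : ℝ} {x>0 : Positive x} {y>0 : Positive y} {z>0 : Positive z} →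
    (∀ i → seq x i ≡ ι n) → (∀ i → seq y i ≡ logDifference 2 (ι n) i) →
    (∀ i → seq z i ≡ constant k (seq π i)) → (∀ i → seq e i ≡ ι (slack n)) →
    1 ℕ.≤ k → 2 ℕ.≤ n → 2 ^ l ℕ.≤ n →
    (c ℕ.≤ 12 × n ℕ.< 512) ⊎ 2 ℕ.* (suc k ^ c ℕ.* suc k ^ c) ℕ.≤ 3 ℕ.* l ℕ.* (k ℕ.* (k ℕ.+ 2) ℕ.* (n ℕ.* n)) →
    c ⊑ (log (suc k) x {{x>0}} + fromℚ ½ * log (suc k) y {{y>0}} + fromℚ ½ * log (suc k) z {{z>0}} + e)
  count-bound-ℝ {k} {c} {n} {l} {x} {y} {z} {e} x≡ y≡ z≡ e≡ 1≤k 2≤n 2^l≤n h = ⊑-intro λ ε 0<ε →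
    -- The logarithms carry a rounding error 2 / (i + 1), hence the index from which 1 / (i + 1) ≤ ε
    -- / 2.
    let d , unit≤ = Sequence.unit (half 0<ε)
        N , 9≤4π = π≥9/4
    in N ℕ.⊔ d , λ i N⊔d≤i →
      count-bound {k} {c} {n} {l} {seq π i} {seq x i} {seq y i} {seq z i} {seq e i} {ε} i (x≡ i) (y≡ i) (z≡ i) (e≡ i)
        (ℚ.<⇒≤ 0<ε) (twice≤ (unit≤ i (ℕ.m⊔n≤o⇒n≤o N d N⊔d≤i)))
        1≤k 2≤n 2^l≤n (9≤4π i (ℕ.m⊔n≤o⇒m≤o N d N⊔d≤i)) h

  ≤+ε : ∀ q {ε} → ℚ.0ℚ ℚ.< ε → q ℚ.≤ q ℚ.+ ε
  ≤+ε q {ε} 0<ε = subst (ℚ._≤ q ℚ.+ ε) (ℚ.+-identityʳ q) (ℚ.+-monoʳ-≤ q (ℚ.<⇒≤ 0<ε))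

  square-size-bound : ∀ {k S n c} → Is𝒟 k S → (S ∩[1, n ]) HasSize c →
    (suc k ^ c) ℕ.* (suc k ^ c) ℕ.≤ k ℕ.* (k ℕ.+ 2) ℕ.* (c ℕ.* (n ℕ.* n)) ℕ.+ 1
  square-size-bound 𝒟 (xs , xs! , ∈⇔ , refl) = 𝒟-bound 𝒟 xs xs!
    (tabulate (λ {s} s∈ → proj₁ (Equivalence.to (∈⇔ s) s∈)))
    (tabulate (λ {s} s∈ → proj₂ (proj₂ (Equivalence.to (∈⇔ s) s∈))))

  size-bound : (k : ℕ) .{{_ : NonZero k}} → ∀ n .{{_ : NonTrivial n}} → let instance n≢0 = nonTrivial⇒nonZero n in
    ∀ {S} → Is𝒟 k S → ∀ c → (S ∩[1, n ]) HasSize c →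
    c ⊑ (log (suc k) (fromℕ n)
         + fromℚ ½ * log (suc k) (log 2 (fromℕ n))
         + fromℚ ½ * log (suc k) (fromℕ 2 * π / fromℕ 3 * fromℕ k * (fromℕ k + fromℕ 2))
         + fromℕ (slack n))
  size-bound k n {S} 𝒟 c size =
    let 1≤k = ℕ.>-nonZero⁻¹ k
        2≤n = ℕ.nonTrivial⇒n>1 n
        1≤n = ℕ.<⇒≤ 2≤n
        l , 2^l≤n , n<2^ = log₂-floor n 1≤n
    in count-bound-ℝ {k} {c} {n} {l} (λ _ → refl) (λ _ → refl) (λ _ → refl) (λ _ → refl) 1≤k 2≤n 2^l≤n
         (few-or-absorbed {k} {c} {n} {l} 1≤k 1≤n n<2^ (square-size-bound {k} {S} {n} {c} 𝒟 size))

theorem6 : (k : ℕ) .{{_ : NonZero k}} →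
    (∃[ e ] Vanishes e ×
    (∀ m (a : Vector ℕ (suc m)) → a Preserves Fin._<_ ⟶ ℕ._<_ → Is𝒟 k (Image a) →
    (fromℕ 1 + e (suc m)) * (fromℕ (suc k ^ suc m) / fromℕ 2)
    * √ (fromℕ 6 / (fromℕ (suc m) * π * fromℕ k * (fromℕ k + fromℕ 2)))
    ≤ fromℕ (last a)))
    ×
    ((S : Pred ℕ 0ℓ) → Inf S → Is𝒟 k S →
    ∃[ e ] Vanishes e ×
    (∀ n .{{_ : NonTrivial n}} → let instance n≢0 = nonTrivial⇒nonZero n in
    ∀ c → (S ∩[1, n ]) HasSize c →
    fromℕ c ≤ log (suc k) (fromℕ n)
    + fromℚ ½ * log (suc k) (log 2 (fromℕ n))
    + fromℚ ½ * log (suc k) (fromℕ 2 * π / fromℕ 3 * fromℕ k * (fromℕ k + fromℕ 2))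
    + e n))
theorem6 k {{k≢0}} =
  ((λ _ → fromℕ 0) , vanishes-zero , λ m a a↗ 𝒟 ε 0<ε →
    -- From the index where the approximations of π stay above 9/4, the inequality holds term by
    -- term.
    proj₁ π≥9/4 , λ i N≤i → ℚ.≤-trans
      (peak-bound-ℝ {suc k ^ suc m} {suc m} {k} {last a} {fromℕ (suc m) * π * fromℕ k * (fromℕ k + fromℕ 2)} i
        (λ _ → refl) (0<ι m) (ι-mono-< {0} 1≤k) (proj₂ π≥9/4 i N≤i) (ι-last-bound {m} {a} a↗ {k} 1≤k 𝒟))
      (≤+ε (ι (last a)) 0<ε)) ,
  λ S _ 𝒟 → (λ n → fromℕ (slack n)) , vanishes-slack , λ n {{n>1}} c size →
    -- With the instances passed explicitly, both types agree syntactically; otherwise Agda compares the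
    -- unfolded sequences.
    size-bound k {{k≢0}} n {{n>1}} 𝒟 c size .⊑⇒≤
  where
  1≤k : 1 ℕ.≤ k
  1≤k = ℕ.>-nonZero⁻¹ k
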